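{- For all positive integers $t$, $$r(n,t)=\begin{cases}\binom{n-2}{2}+t & \text{for } n\ge 2t+2,\\ \binom{n-1}{2} & \text{for } n=2t+1,\\ \binom{n}{2}-t & \text{for } n=2t.\end{cases}$$
   Context: $r(n,t)$ denotes the maximum number of colors in an edge-coloring of the complete graph $K_n$ that does not have $t$ edge-disjoint rainbow spanning trees. A rainbow spanning tree is a spanning tree whose edges all have distinct colors. -}

module Defs where

open import Data.Nat using (ℕ; zero; suc; _+_; _≤_) renaming (_<_ to _<ℕ_)
open import Data.Fin using (Fin; _<_)
open import Data.List using (List; []; _∷_; length)
open import Data.List.Relation.Unary.Unique.Propositional using (Unique)
open import Data.Product using (Σ; Σ-syntax; _×_)
open import Data.Sum using (_⊎_)
open import Data.Empty using (⊥)
open import Relation.Nullary using (¬_)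
open import Relation.Binary.PropositionalEquality using (_≡_; _≢_)

-- An edge of the complete graph K_n on vertex set Fin n: a pair lo < hi.
record Edge (n : ℕ) : Set where
  constructor edge
  field
    lo hi : Fin n
    lo<hi : lo < hi
open Edge public

_≈E_ : ∀ {n} → Edge n → Edge n → Set
e ≈E f = (lo e ≡ lo f) × (hi e ≡ hi f)

Joins : ∀ {n} → Edge n → Fin n → Fin n → Set
Joins e u v = ((lo e ≡ u) × (hi e ≡ v)) ⊎ ((lo e ≡ v) × (hi e ≡ u))

-- A (spanning) subgraph of K_n, given by its edge set.
EdgeSet : ℕ → Set₁
EdgeSet n = Edge n → Set

Adj : ∀ {n} → EdgeSet n → Fin n → Fin n → Set
Adj {n} T u v = Σ[ e ∈ Edge n ] (T e × Joins e u v)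

data Walk {n} (T : EdgeSet n) : Fin n → Fin n → Set where
  here : ∀ {u} → Walk T u u
  step : ∀ {u w v} → Adj T u w → Walk T w v → Walk T u v

Connected : ∀ {n} → EdgeSet n → Set
Connected T = ∀ u v → Walk T u v

Chain : ∀ {n} → EdgeSet n → Fin n → List (Fin n) → Fin n → Set
Chain T u []       v = Adj T u v
Chain T u (x ∷ xs) v = Adj T u x × Chain T x xs v

Cycle : ∀ {n} → EdgeSet n → Set
Cycle {n} T = Σ[ v0 ∈ Fin n ] Σ[ ws ∈ List (Fin n) ]
  ((2 ≤ length ws) × Unique (v0 ∷ ws) × Chain T v0 ws v0)

SpanningTree : ∀ {n} → EdgeSet n → Set
SpanningTree T = Connected T × ¬ Cycle T

Coloring : ℕ → ℕ → Set
Coloring n k = Edge n → Fin k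

Surjective : ∀ {n k} → Coloring n k → Set
Surjective {n} {k} c = ∀ (a : Fin k) → Σ[ e ∈ Edge n ] (c e ≡ a)

Rainbow : ∀ {n k} → Coloring n k → EdgeSet n → Set
Rainbow {n} c T = ∀ (e f : Edge n) → T e → T f → c e ≡ c f → e ≈E f

EdgeDisjoint : ∀ {n} → EdgeSet n → EdgeSet n → Set
EdgeDisjoint {n} T T' = ∀ (e : Edge n) → T e → T' e → ⊥

HasRainbowTrees : ∀ {n k} → ℕ → Coloring n k → Set₁
HasRainbowTrees {n} t c =
  Σ[ Ts ∈ (Fin t → EdgeSet n) ]
    ((∀ i → SpanningTree (Ts i)) × (∀ i → Rainbow c (Ts i))
     × (∀ i j → i ≢ j → EdgeDisjoint (Ts i) (Ts j)))

Bad : ℕ → ℕ → ℕ → Set₁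
Bad n t k = Σ[ c ∈ Coloring n k ] (Surjective c × ¬ HasRainbowTrees t c)

-- r(n,t) = r : r is the maximum k with Bad n t k (convention: max of the empty set is 0).
IsR : ℕ → ℕ → ℕ → Set₁
IsR n t r = ((r ≡ 0) ⊎ Bad n t r)
          × (∀ k → r <ℕ k → (c : Coloring n k) → Surjective c → HasRainbowTrees t c)

{-# OPTIONS --safe #-}
module Submission where

-- Upper bound.  Merging colours, we may assume that there is exactly one colour more than
-- claimed.  A greedy argument gives a set A of t - 1 edges such that every colour occurs on
-- H = E \ A and every vertex v sees at least t - deg_A(v) colours of H.  Reserve the i-th
-- edge aᵢ of A for the i-th tree (one tree gets none) and extend the trees by edges of H,
-- each colour being used at most once in total and never in the tree whose reserved edge
-- has it.  By Rado's theorem for the direct sum of t graphic matroids this is possible if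
--     ∑ᵢ comp(aᵢ ∪ H_{J ∖ c(aᵢ)}) + |J| ≤ k + t    for every set J of colours,
-- where comp counts components.  If deleting a colour from J separates the ends of one of
-- its edges, J may be shrunk; otherwise the components do not change when c(aᵢ) is deleted
-- and the inequality follows by counting the edges inside the components.
--
-- Lower bound.  Give distinct colours to the edges of a graph N with q + 2 components and
-- to tq - 1 further edges, and one common colour to all other edges.  Each rainbow spanning
-- tree uses at least q of the tq - 1 further edges.  Take N empty, or a clique on n - 2
-- vertices.

open import Defs
open import Data.Nat using (ℕ; zero; suc; pred; _+_; _*_; _∸_; _≤_; _<_; z≤n; s≤s; _<?_; _⊓_)
open import Data.Nat.Properties hiding (_≟_; suc-injective; <-cmp)
open import Data.Nat.Combinatorics using (_C_; nC1≡n; nCk+nC[k+1]≡[n+1]C[k+1])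
open import Data.Nat.Tactic.RingSolver using (solve-∀)
open import Data.Fin using (Fin; zero; suc; toℕ; fromℕ<)
open import Data.Fin.Properties using (_≟_; any?; suc-injective; toℕ<n; toℕ-injective; toℕ-fromℕ<; <-cmp)
open import Data.Fin.Subset using (Subset; _∪_; _∩_; _-_; _⊂_; ⊤) renaming (_∈_ to _∈ˢ_)
open import Data.Fin.Subset.Properties using (anySubset?; x∈p∪q⁺; x∈p∪q⁻; x∈p∩q⁺; x∈p∩q⁻; x∈p∧x≢y⇒x∈p-y; p─q⊆p; x∈p⇒p-x⊂p; ∈⊤) renaming (_∈?_ to _∈ˢ?_)
open import Data.Fin.Subset.Induction using (⊂-wellFounded)
open import Data.List using (List; []; _∷_; _++_; map; filter; length; lookup; take; drop; cartesianProduct)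
open import Data.List.Properties using (length-map; length-++; length-take; take++drop≡id; ++-assoc; ++-identityʳ; map-++)
open import Data.List.Membership.Propositional using (_∈_; find; lose)
open import Data.List.Membership.Propositional.Properties using (∈-map⁺; ∈-map⁻; ∈-++⁺ˡ; ∈-++⁺ʳ; ∈-++⁻; ∈-filter⁺; ∈-filter⁻; ∈-lookup; ∈-cartesianProduct⁺; ∈-cartesianProduct⁻; ∈-∃++)
import Data.List.Membership.DecPropositional as DecMembership
open import Data.List.Relation.Binary.Subset.Propositional using (_⊆_)
open import Data.List.Relation.Unary.All as All using (All; []; _∷_)
open import Data.List.Relation.Unary.Any as Any using (Any; here; there; index)
open import Data.List.Relation.Unary.Any.Properties using (lookup-index)
open import Data.List.Relation.Unary.AllPairs using ([]; _∷_)
open import Data.List.Relation.Unary.Unique.Propositional using (Unique)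
import Data.List.Relation.Unary.Unique.Propositional.Properties as Unique
open import Data.Product using (Σ-syntax; ∃; _×_; _,_; proj₁; proj₂)
open import Data.Sum using (_⊎_; inj₁; inj₂)
open import Data.Unit using (tt) renaming (⊤ to 𝟙)
open import Data.Empty using (⊥; ⊥-elim)
open import Function using (_∘_; id)
open import Induction.WellFounded using (Acc; acc)
open import Relation.Nullary using (¬_; Dec; yes; no)
open import Relation.Nullary.Decidable using (¬?; _×-dec_; _⊎-dec_; map′)
open import Relation.Binary using (tri<; tri≈; tri>)
open import Relation.Binary.PropositionalEquality using (_≡_; _≢_; refl; sym; trans; cong; cong₂; subst; module ≡-Reasoning)
import Data.Vec as Vec

-- Why t - 1 reserved edges: if each colour is used once over all trees, only k edges are available,
-- while t trees need t(n - 1). With k one more than the claimed value, the shortfall is exactly t -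
-- 1 for n = 2t, 2t + 1 and 2t + 2; and for n = 2t no more than t - 1 edges can be set aside if
-- every colour is still to occur on H.
--
-- Why a condition at vertices: counting the edges inside components suffices unless J leaves just
-- two components, one of them a single vertex. For n ≥ 2t + 2 a clique on the other n - 1 vertices
-- has at least k edges, so the count says nothing there and the colours seen at the vertex must
-- help.
--
-- Where the formula comes from: with p ≥ 3 components the count needs k > t(p - 2) + C(n + 1 - p,
-- 2). The right side is convex in p, so its ends p = 3 and p = n decide. They are the values of the
-- two lower-bound colourings, the clique and the empty N, and they agree at n = 2t + 2, where the
-- formula changes.

private
  variable
    X Y P Q : Set
    n m k : ℕ

-- Finite sums and counting

ι : Dec P → ℕ
ι (yes _) = 1
ι (no _)  = 0

ι-yes : (d : Dec P) → P → ι d ≡ 1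
ι-yes (yes _) _ = refl
ι-yes (no ¬p) p = ⊥-elim (¬p p)

ι-no : (d : Dec P) → ¬ P → ι d ≡ 0
ι-no (yes p) ¬p = ⊥-elim (¬p p)
ι-no (no _)  _  = refl

ι-mono : (d : Dec P) (d′ : Dec Q) → (P → Q) → ι d ≤ ι d′
ι-mono (no _)  _  _ = z≤n
ι-mono (yes p) d′ f = ≤-reflexive (sym (ι-yes d′ (f p)))

ι-cong : (d : Dec P) (d′ : Dec Q) → (P → Q) → (Q → P) → ι d ≡ ι d′
ι-cong d d′ f g = ≤-antisym (ι-mono d d′ f) (ι-mono d′ d g)

ι≤1 : (d : Dec P) → ι d ≤ 1
ι≤1 (yes _) = ≤-refl
ι≤1 (no _)  = z≤n

ι+ι¬ : (d : Dec P) (d′ : Dec (¬ P)) → ι d + ι d′ ≡ 1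
ι+ι¬ (yes p) d′ = cong suc (ι-no d′ (λ ¬p → ¬p p))
ι+ι¬ (no ¬p) d′ = ι-yes d′ ¬p

ι-split : (d : Dec P) (d₁ : Dec Q) (d₂ : Dec X) → (P → Q ⊎ X) → ι d ≤ ι d₁ + ι d₂
ι-split (no _)  _  _  _ = z≤n
ι-split (yes p) d₁ d₂ f with f p
... | inj₁ q = ≤-trans (≤-reflexive (sym (ι-yes d₁ q))) (m≤m+n _ _)
... | inj₂ x = ≤-trans (≤-reflexive (sym (ι-yes d₂ x))) (m≤n+m _ _)

ι-disjoint : (d₁ : Dec P) (d₂ : Dec Q) (d : Dec X) → (P → X) → (Q → X) → (P → Q → ⊥) → ι d₁ + ι d₂ ≤ ι d
ι-disjoint (no _)  d₂ d _ g _ = ι-mono d₂ d g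
ι-disjoint (yes p) d₂ d f _ h = ≤-trans (≤-reflexive (cong suc (ι-no d₂ (h p)))) (≤-reflexive (sym (ι-yes d (f p))))

-- For linear arithmetic: l ≤ r is a sum of hypotheses, c the slack, and the identity is left to the ring solver.
linear : ∀ {l r L R} c → l ≤ r → L + r + c ≡ R + l → L ≤ R
linear {l} {r} {L} {R} c l≤r eq = +-cancelʳ-≤ r L R (≤-trans (m≤m+n (L + r) c)
  (≤-trans (≤-reflexive eq) (+-monoʳ-≤ R l≤r)))

∑ : List X → (X → ℕ) → ℕ
∑ []       f = 0
∑ (x ∷ xs) f = f x + ∑ xs f

∑-mono∈ : ∀ (xs : List X) {f g} → (∀ {x} → x ∈ xs → f x ≤ g x) → ∑ xs f ≤ ∑ xs g
∑-mono∈ []       h = z≤n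
∑-mono∈ (x ∷ xs) h = +-mono-≤ (h (here refl)) (∑-mono∈ xs (h ∘ there))

∑-mono : ∀ (xs : List X) {f g} → (∀ x → f x ≤ g x) → ∑ xs f ≤ ∑ xs g
∑-mono xs h = ∑-mono∈ xs (λ {x} _ → h x)

∑-strict : ∀ (xs : List X) {f g : X → ℕ} → (∀ x → f x ≤ g x) → ∀ {x} → x ∈ xs → suc (f x) ≤ g x → suc (∑ xs f) ≤ ∑ xs g
∑-strict (y ∷ xs) h (here refl) lt = +-mono-≤ lt (∑-mono xs h)
∑-strict (y ∷ xs) h (there x∈) lt = ≤-trans (≤-reflexive (sym (+-suc _ _))) (+-mono-≤ (h y) (∑-strict xs h x∈ lt))

∑-cong : ∀ (xs : List X) {f g} → (∀ x → f x ≡ g x) → ∑ xs f ≡ ∑ xs g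
∑-cong []       h = refl
∑-cong (x ∷ xs) h = cong₂ _+_ (h x) (∑-cong xs h)

∑-+ : ∀ (xs : List X) f g → ∑ xs (λ x → f x + g x) ≡ ∑ xs f + ∑ xs g
∑-+ []       f g = refl
∑-+ (x ∷ xs) f g = trans (cong (f x + g x +_) (∑-+ xs f g)) (shuffle (f x) (g x) (∑ xs f) (∑ xs g))
  where
  shuffle : ∀ a b c d → a + b + (c + d) ≡ a + c + (b + d)
  shuffle = solve-∀

∑-const : ∀ (xs : List X) c → ∑ xs (λ _ → c) ≡ length xs * c
∑-const []       c = refl
∑-const (x ∷ xs) c = cong (c +_) (∑-const xs c)

∑-zero : ∀ (xs : List X) → ∑ xs (λ _ → 0) ≡ 0
∑-zero xs = trans (∑-const xs 0) (*-zeroʳ (length xs))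

∑-one : ∀ (xs : List X) → ∑ xs (λ _ → 1) ≡ length xs
∑-one xs = trans (∑-const xs 1) (*-identityʳ (length xs))

∑-map : ∀ (xs : List X) (g : X → Y) f → ∑ (map g xs) f ≡ ∑ xs (f ∘ g)
∑-map []       g f = refl
∑-map (x ∷ xs) g f = cong (f (g x) +_) (∑-map xs g f)

∑-++ : ∀ (xs ys : List X) f → ∑ (xs ++ ys) f ≡ ∑ xs f + ∑ ys f
∑-++ []       ys f = refl
∑-++ (x ∷ xs) ys f = trans (cong (f x +_) (∑-++ xs ys f)) (sym (+-assoc (f x) _ _))

∑-swap : ∀ (xs : List X) (ys : List Y) (f : X → Y → ℕ) →
         ∑ xs (λ x → ∑ ys (f x)) ≡ ∑ ys (λ y → ∑ xs (λ x → f x y))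
∑-swap []       ys f = sym (∑-zero ys)
∑-swap (x ∷ xs) ys f = trans (cong (∑ ys (f x) +_) (∑-swap xs ys f)) (sym (∑-+ ys (f x) _))

∈⇒≤∑ : ∀ {xs : List X} {x} f → x ∈ xs → f x ≤ ∑ xs f
∈⇒≤∑ f (here refl) = m≤m+n _ _
∈⇒≤∑ {xs = y ∷ _} f (there x∈) = ≤-trans (∈⇒≤∑ f x∈) (m≤n+m _ (f y))

∑-none : ∀ {A : X → Set} (A? : ∀ x → Dec (A x)) xs → (∀ {x} → x ∈ xs → ¬ A x) → ∑ xs (ι ∘ A?) ≡ 0
∑-none A? []       h = refl
∑-none A? (x ∷ xs) h = cong₂ _+_ (ι-no (A? x) (h (here refl))) (∑-none A? xs (h ∘ there))

∑-atMostOne : ∀ {A : X → Set} (A? : ∀ x → Dec (A x)) (q : Dec Q) {xs} → Unique xs →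
              (∀ {x} → x ∈ xs → A x → Q) → (∀ {x y} → x ∈ xs → y ∈ xs → A x → A y → x ≡ y) →
              ∑ xs (ι ∘ A?) ≤ ι q
∑-atMostOne A? q {[]}     u h eq = z≤n
∑-atMostOne A? q {x ∷ xs} (x≢ ∷ u) h eq with A? x
... | no _  = ∑-atMostOne A? q u (h ∘ there) (λ y∈ z∈ → eq (there y∈) (there z∈))
... | yes a = ≤-reflexive (trans (cong suc (∑-none A? xs λ y∈ b → All.lookup x≢ y∈ (eq (here refl) (there y∈) a b)))
                                 (sym (ι-yes q (h (here refl) a))))

∑-two : ∀ {A : X → Set} (A? : ∀ x → Dec (A x)) {xs x y} → x ∈ xs → y ∈ xs → x ≢ y → A x → A y →
        2 ≤ ∑ xs (ι ∘ A?)
∑-two A? (here refl) (here refl) x≢y a b = ⊥-elim (x≢y refl)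
∑-two A? {x = x} {y} (here refl) (there y∈) x≢y a b =
  +-mono-≤ (≤-reflexive (sym (ι-yes (A? x) a))) (≤-trans (≤-reflexive (sym (ι-yes (A? y) b))) (∈⇒≤∑ (ι ∘ A?) y∈))
∑-two A? {x = x} {y} (there x∈) (here refl) x≢y a b =
  +-mono-≤ (≤-reflexive (sym (ι-yes (A? y) b))) (≤-trans (≤-reflexive (sym (ι-yes (A? x) a))) (∈⇒≤∑ (ι ∘ A?) x∈))
∑-two A? {xs = z ∷ _} (there x∈) (there y∈) x≢y a b = ≤-trans (∑-two A? x∈ y∈ x≢y a b) (m≤n+m _ (ι (A? z)))

-- Double counting of the pairs in `R`: every counted `x` has a partner and no `y` has two. A
-- relation in place of a function lets the partners be arbitrary witnesses.
∑-injection : ∀ {A : X → Set} {B : Y → Set} {R : X → Y → Set}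
  (A? : ∀ x → Dec (A x)) (B? : ∀ y → Dec (B y)) (R? : ∀ x y → Dec (R x y)) {xs} → Unique xs → ∀ ys →
  (∀ {x} → x ∈ xs → A x → Σ[ y ∈ Y ] (y ∈ ys × R x y)) →
  (∀ {x y} → x ∈ xs → R x y → B y) →
  (∀ {x x′ y} → R x y → R x′ y → x ≡ x′) →
  ∑ xs (ι ∘ A?) ≤ ∑ ys (ι ∘ B?)
∑-injection A? B? R? {xs} u ys total lands inj = begin
  ∑ xs (ι ∘ A?)                          ≤⟨ ∑-mono∈ xs hit ⟩
  ∑ xs (λ x → ∑ ys (λ y → ι (R? x y)))   ≡⟨ ∑-swap xs ys _ ⟩
  ∑ ys (λ y → ∑ xs (λ x → ι (R? x y)))   ≤⟨ ∑-mono ys (λ y → ∑-atMostOne (λ x → R? x y) (B? y) u lands (λ _ _ → inj)) ⟩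
  ∑ ys (ι ∘ B?)                          ∎
  where
  open ≤-Reasoning
  hit : ∀ {x} → x ∈ xs → ι (A? x) ≤ ∑ ys (λ y → ι (R? x y))
  hit {x} x∈ with A? x
  ... | no _  = z≤n
  ... | yes a with total x∈ a
  ...   | y , y∈ , r = ≤-trans (≤-reflexive (sym (ι-yes (R? x y) r))) (∈⇒≤∑ (λ y → ι (R? x y)) y∈)

∑-filter : ∀ {A : X → Set} (A? : ∀ x → Dec (A x)) xs f → (∀ x → ¬ A x → f x ≡ 0) →
           ∑ xs f ≡ ∑ (filter A? xs) f
∑-filter A? []       f h = refl
∑-filter A? (x ∷ xs) f h with A? x
... | yes _ = cong (f x +_) (∑-filter A? xs f h)
... | no ¬a = cong₂ _+_ (h x ¬a) (∑-filter A? xs f h)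

length-filter-∑ : ∀ {A : X → Set} (A? : ∀ x → Dec (A x)) xs → length (filter A? xs) ≡ ∑ xs (ι ∘ A?)
length-filter-∑ A? [] = refl
length-filter-∑ A? (x ∷ xs) with A? x
... | yes _ = cong suc (length-filter-∑ A? xs)
... | no _  = length-filter-∑ A? xs

-- Turns a bound of t on the sum of t component counts, each at least 1, into connectedness of every
-- tree.
∑-tight : ∀ (xs : List X) f → (∀ x → 1 ≤ f x) → ∑ xs f ≤ length xs → ∀ {x} → x ∈ xs → f x ≤ 1
∑-tight (y ∷ xs) f pos le (here refl) = +-cancelʳ-≤ (length xs) (f y) 1
  (≤-trans (+-monoʳ-≤ (f y) (≤-trans (≤-reflexive (sym (∑-one xs))) (∑-mono xs pos))) le)
∑-tight (y ∷ xs) f pos le (there x∈) = ∑-tight xs f pos (+-cancelˡ-≤ 1 _ _ (≤-trans (+-monoˡ-≤ (∑ xs f) (pos y)) le)) x∈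

∑-positive : ∀ (xs : List X) f → 1 ≤ ∑ xs f → Σ[ x ∈ X ] (x ∈ xs × 1 ≤ f x)
∑-positive (x ∷ xs) f le with f x in eq
... | suc _ = x , here refl , ≤-trans (s≤s z≤n) (≤-reflexive (sym eq))
... | zero with ∑-positive xs f le
...   | y , y∈ , p = y , there y∈ , p

fins : ∀ n → List (Fin n)
fins zero    = []
fins (suc n) = zero ∷ map suc (fins n)

∈fins : (i : Fin n) → i ∈ fins n
∈fins zero    = here refl
∈fins (suc i) = there (∈-map⁺ suc (∈fins i))

fins-unique : ∀ n → Unique (fins n)
fins-unique zero    = []
fins-unique (suc n) = All.tabulate (λ i∈ → λ { refl → zero∉ i∈ }) ∷ Unique.map⁺ suc-injective (fins-unique n)
  where
  zero∉ : ¬ (zero ∈ map suc (fins n))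
  zero∉ z∈ with ∈-map⁻ suc z∈
  ... | _ , _ , ()

length-fins : ∀ n → length (fins n) ≡ n
length-fins zero    = refl
length-fins (suc n) = cong suc (trans (length-map suc (fins n)) (length-fins n))

∑-fins-suc : ∀ n (f : Fin (suc n) → ℕ) → ∑ (fins (suc n)) f ≡ f zero + ∑ (fins n) (f ∘ suc)
∑-fins-suc n f = cong (f zero +_) (∑-map (fins n) suc f)

∑-fins-lookup : ∀ (xs : List X) f → ∑ (fins (length xs)) (f ∘ lookup xs) ≡ ∑ xs f
∑-fins-lookup []       f = refl
∑-fins-lookup (x ∷ xs) f = trans (∑-fins-suc (length xs) (f ∘ lookup (x ∷ xs))) (cong (f x +_) (∑-fins-lookup xs f))

∑-≟ : (c : Fin n) → ∑ (fins n) (λ x → ι (x ≟ c)) ≤ 1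
∑-≟ {n} c = ∑-atMostOne (_≟ c) (yes tt) (fins-unique n) (λ _ _ → tt) (λ { _ _ refl refl → refl })

count-complement : ∀ {A : Fin n → Set} (A? : ∀ x → Dec (A x)) → ∑ (fins n) (ι ∘ A?) + ∑ (fins n) (ι ∘ ¬? ∘ A?) ≡ n
count-complement {n} A? = begin
  ∑ (fins n) (ι ∘ A?) + ∑ (fins n) (ι ∘ ¬? ∘ A?)   ≡⟨ ∑-+ (fins n) _ _ ⟨
  ∑ (fins n) (λ x → ι (A? x) + ι (¬? (A? x)))      ≡⟨ ∑-cong (fins n) (λ x → ι+ι¬ (A? x) (¬? (A? x))) ⟩
  ∑ (fins n) (λ _ → 1)                             ≡⟨ ∑-one (fins n) ⟩
  length (fins n)                                  ≡⟨ length-fins n ⟩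
  n                                                ∎
  where open ≡-Reasoning

lookup-injective : ∀ {xs : List X} → Unique xs → ∀ {i j} → lookup xs i ≡ lookup xs j → i ≡ j
lookup-injective (x≢ ∷ u) {zero}  {zero}  eq = refl
lookup-injective {xs = _ ∷ xs} (x≢ ∷ u) {zero}  {suc j} eq = ⊥-elim (All.lookup x≢ (∈-lookup {xs = xs} j) eq)
lookup-injective {xs = _ ∷ xs} (x≢ ∷ u) {suc i} {zero}  eq = ⊥-elim (All.lookup x≢ (∈-lookup {xs = xs} i) (sym eq))
lookup-injective (x≢ ∷ u) {suc i} {suc j} eq = cong suc (lookup-injective u eq)

-- Edges of the complete graph

tri : ℕ → ℕ
tri zero    = 0
tri (suc n) = n + tri n

C2≡tri : ∀ n → n C 2 ≡ tri n
C2≡tri zero    = refl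
C2≡tri (suc n) = trans (sym (nCk+nC[k+1]≡[n+1]C[k+1] n 1)) (cong₂ _+_ (nC1≡n n) (C2≡tri n))

tri-mono : m ≤ n → tri m ≤ tri n
tri-mono z≤n     = z≤n
tri-mono (s≤s p) = +-mono-≤ p (tri-mono p)

edge-≡ : ∀ {e f : Edge n} → lo e ≡ lo f → hi e ≡ hi f → e ≡ f
edge-≡ {e = edge u v p} {edge _ _ q} refl refl = cong (edge u v) (<-irrelevant p q)

infix 4 _≟ᴱ_
_≟ᴱ_ : (e f : Edge n) → Dec (e ≡ f)
e ≟ᴱ f = map′ (λ (p , q) → edge-≡ p q) (λ { refl → refl , refl }) ((lo e ≟ lo f) ×-dec (hi e ≟ hi f))

module _ {n : ℕ} where
  open DecMembership (_≟ᴱ_ {n}) public using (_∈?_)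

spoke : Fin n → Edge (suc n)
spoke j = edge zero (suc j) (s≤s z≤n)

shift : Edge n → Edge (suc n)
shift (edge u v p) = edge (suc u) (suc v) (s≤s p)

edges : ∀ n → List (Edge n)
edges zero    = []
edges (suc n) = map spoke (fins n) ++ map shift (edges n)

∈edges : (e : Edge n) → e ∈ edges n
∈edges {suc n} (edge zero (suc v) (s≤s z≤n)) = ∈-++⁺ˡ (∈-map⁺ spoke (∈fins v))
∈edges {suc n} (edge (suc u) (suc v) (s≤s p)) = ∈-++⁺ʳ (map spoke (fins n)) (∈-map⁺ shift (∈edges (edge u v p)))

edges-unique : ∀ n → Unique (edges n)
edges-unique zero    = []
edges-unique (suc n) = Unique.++⁺ (Unique.map⁺ (λ { refl → refl }) (fins-unique n))
                                  (Unique.map⁺ (λ { refl → refl }) (edges-unique n)) disjoint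
  where
  disjoint : ∀ {e} → ¬ (e ∈ map spoke (fins n) × e ∈ map shift (edges n))
  disjoint (p , q) with ∈-map⁻ spoke p | ∈-map⁻ shift q
  ... | _ , _ , refl | _ , _ , ()

∑-edges-suc : ∀ n (f : Edge (suc n) → ℕ) →
              ∑ (edges (suc n)) f ≡ ∑ (fins n) (f ∘ spoke) + ∑ (edges n) (f ∘ shift)
∑-edges-suc n f = trans (∑-++ (map spoke (fins n)) _ f) (cong₂ _+_ (∑-map (fins n) spoke f) (∑-map (edges n) shift f))

length-edges : ∀ n → length (edges n) ≡ tri n
length-edges zero    = refl
length-edges (suc n) = trans (length-++ (map spoke (fins n)))
  (cong₂ _+_ (trans (length-map spoke (fins n)) (length-fins n)) (trans (length-map shift (edges n)) (length-edges n)))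

edges-inside : ∀ {A : Fin n → Set} (A? : ∀ v → Dec (A v)) →
  ∑ (edges n) (λ e → ι (A? (lo e) ×-dec A? (hi e))) ≡ tri (∑ (fins n) (ι ∘ A?))
edges-inside {zero}  A? = refl
edges-inside {suc n} A? = trans (∑-edges-suc n _) (trans (cong₂ _+_ refl (edges-inside (A? ∘ suc)))
    (trans body (cong tri (sym (∑-fins-suc n (ι ∘ A?))))))
  where
  N = ∑ (fins n) (ι ∘ A? ∘ suc)
  body : ∑ (fins n) (λ j → ι (A? zero ×-dec A? (suc j))) + tri N ≡ tri (ι (A? zero) + N)
  body with A? zero
  ... | yes a = cong (_+ tri N) (∑-cong (fins n) λ j → ι-cong (yes a ×-dec A? (suc j)) (A? (suc j)) proj₂ (a ,_))
  ... | no ¬a = cong (_+ tri N) (trans (∑-cong (fins n) λ j → ι-no (no ¬a ×-dec A? (suc j)) (¬a ∘ proj₁)) (∑-zero (fins n)))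

Incident : Fin n → Edge n → Set
Incident v e = lo e ≡ v ⊎ hi e ≡ v

incident? : (v : Fin n) (e : Edge n) → Dec (Incident v e)
incident? v e = (lo e ≟ v) ⊎-dec (hi e ≟ v)

joins? : (e : Edge n) (u v : Fin n) → Dec (Joins e u v)
joins? e u v = ((lo e ≟ u) ×-dec (hi e ≟ v)) ⊎-dec ((lo e ≟ v) ×-dec (hi e ≟ u))

joining-edge : (u v : Fin n) → u ≢ v → Σ[ e ∈ Edge n ] Joins e u v
joining-edge u v u≢v with <-cmp u v
... | tri< u<v _ _ = edge u v u<v , inj₁ (refl , refl)
... | tri≈ _ u≡v _ = ⊥-elim (u≢v u≡v)
... | tri> _ _ v<u = edge v u v<u , inj₂ (refl , refl)

joins⇒incident : ∀ {e : Edge n} {u v} → Joins e u v → Incident u e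
joins⇒incident (inj₁ (p , _)) = inj₁ p
joins⇒incident (inj₂ (_ , p)) = inj₂ p

joins-injective : ∀ {e : Edge n} {u v w} → Joins e u v → Joins e u w → v ≡ w
joins-injective (inj₁ (refl , refl)) (inj₁ (refl , refl)) = refl
joins-injective (inj₁ (refl , refl)) (inj₂ (refl , refl)) = refl
joins-injective (inj₂ (refl , refl)) (inj₁ (refl , refl)) = refl
joins-injective (inj₂ (refl , refl)) (inj₂ (refl , refl)) = refl

degree-complete : (v : Fin n) → n ≤ suc (∑ (edges n) (ι ∘ incident? v))
degree-complete {n} v = begin
  n                                                                     ≡⟨ count-complement (_≟ v) ⟨
  ∑ (fins n) (λ w → ι (w ≟ v)) + ∑ (fins n) (λ w → ι (¬? (w ≟ v)))      ≤⟨ +-mono-≤ (∑-≟ v) others ⟩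
  suc (∑ (edges n) (ι ∘ incident? v))                                   ∎
  where
  open ≤-Reasoning
  others : ∑ (fins n) (λ w → ι (¬? (w ≟ v))) ≤ ∑ (edges n) (ι ∘ incident? v)
  others = ∑-injection (λ w → ¬? (w ≟ v)) (incident? v) (λ w e → joins? e v w) (fins-unique n) (edges n)
    (λ {w} _ w≢v → let e , j = joining-edge v w (w≢v ∘ sym) in e , ∈edges e , j)
    (λ {w} {e} _ → joins⇒incident {e = e} {v} {w}) (λ {w} {w′} {e} → joins-injective {e = e} {v} {w} {w′})

-- Number of distinct values of a function

Hits : (Fin n → Fin m) → Fin m → Set
Hits f x = ∃ λ j → f j ≡ x

hits? : (f : Fin n → Fin m) (x : Fin m) → Dec (Hits f x)
hits? f x = any? (λ j → f j ≟ x)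

distinct : (Fin n → Fin m) → ℕ
distinct {zero}  f = 0
distinct {suc n} f = ι (¬? (hits? (f ∘ suc) (f zero))) + distinct (f ∘ suc)

distinct-anti : ∀ {l} {f : Fin n → Fin m} {g : Fin n → Fin l} → (∀ u v → f u ≡ f v → g u ≡ g v) → distinct g ≤ distinct f
distinct-anti {zero}  h = z≤n
distinct-anti {suc n} {f = f} {g} h = +-mono-≤
  (ι-mono (¬? (hits? (g ∘ suc) (g zero))) (¬? (hits? (f ∘ suc) (f zero))) (λ ¬hit → λ { (j , eq) → ¬hit (j , h (suc j) zero eq) }))
  (distinct-anti (λ u v → h (suc u) (suc v)))

distinct≤n : (f : Fin n → Fin m) → distinct f ≤ n
distinct≤n {zero}  f = z≤n
distinct≤n {suc n} f = +-mono-≤ (ι≤1 (¬? (hits? (f ∘ suc) (f zero)))) (distinct≤n (f ∘ suc))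

1≤distinct : (f : Fin (suc n) → Fin m) → 1 ≤ distinct f
1≤distinct {zero}  f = ≤-trans (≤-reflexive (sym (ι-yes (¬? (hits? (f ∘ suc) (f zero))) λ ()))) (m≤m+n _ _)
1≤distinct {suc n} f = ≤-trans (1≤distinct (f ∘ suc)) (m≤n+m _ (ι (¬? (hits? (f ∘ suc) (f zero)))))

distinct-constant : (f : Fin n → Fin m) → (∀ u v → f u ≡ f v) → distinct f ≤ 1
distinct-constant {zero}        f h = z≤n
distinct-constant {suc zero}    f h = +-mono-≤ (ι≤1 (¬? (hits? (f ∘ suc) (f zero)))) z≤n
distinct-constant {suc (suc n)} f h = +-mono-≤
  (≤-reflexive (ι-no (¬? (hits? (f ∘ suc) (f zero))) (λ ¬hit → ¬hit (zero , h _ _))))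
  (distinct-constant (f ∘ suc) (λ u v → h (suc u) (suc v)))

distinct-id : ∀ n → distinct {n} id ≡ n
distinct-id n = injective id (λ u v eq → eq)
  where
  injective : ∀ {n m} (f : Fin n → Fin m) → (∀ u v → f u ≡ f v → u ≡ v) → distinct f ≡ n
  injective {zero}  f h = refl
  injective {suc n} f h = cong₂ _+_ (ι-yes (¬? (hits? (f ∘ suc) (f zero))) λ { (j , eq) → suc≢zero (h (suc j) zero eq) })
                                    (injective (f ∘ suc) (λ u v eq → suc-injective (h (suc u) (suc v) eq)))
    where
    suc≢zero : ∀ {n} {j : Fin n} → _≢_ {A = Fin (suc n)} (suc j) zero
    suc≢zero ()

replace : Fin m → Fin m → Fin m → Fin m
replace x y z with z ≟ y
... | yes _ = x
... | no _  = z

replace-≡ : ∀ {x y z : Fin m} → z ≡ y → replace x y z ≡ x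
replace-≡ {y = y} {z} eq with z ≟ y
... | yes _ = refl
... | no ne = ⊥-elim (ne eq)

replace-≢ : ∀ {x y z : Fin m} → z ≢ y → replace x y z ≡ z
replace-≢ {y = y} {z} ne with z ≟ y
... | yes eq = ⊥-elim (ne eq)
... | no _   = refl

hits-replace⁺ : ∀ {x y} (f : Fin n → Fin m) → Hits f x ⊎ Hits f y → Hits (replace x y ∘ f) x
hits-replace⁺ {x = x} {y} f (inj₂ (j , eq)) = j , replace-≡ eq
hits-replace⁺ {x = x} {y} f (inj₁ (j , eq)) with f j ≟ y
... | yes p = j , replace-≡ p
... | no p  = j , trans (replace-≢ p) eq

hits-replace⁻ : ∀ {x y} (f : Fin n → Fin m) → Hits (replace x y ∘ f) x → Hits f x ⊎ Hits f y
hits-replace⁻ {y = y} f (j , eq) with f j ≟ y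
... | yes p = inj₂ (j , p)
... | no _  = inj₁ (j , eq)

-- The correction term serves the induction: the labels merged by an edge are both attained, but
-- removing a vertex may remove the last occurrence of `x` or `y`, and then merging loses no value.
distinct-replace : ∀ {x y} (f : Fin n → Fin m) → x ≢ y →
  distinct (replace x y ∘ f) + ι (hits? f x ×-dec hits? f y) ≡ distinct f
distinct-replace {zero}  {x = x} {y} f x≢y = ι-no (hits? f x ×-dec hits? f y) λ ()
distinct-replace {suc n} {x = x} {y} f x≢y = begin
  a + distinct (r ∘ g) + h     ≡⟨ shuffle a (distinct (r ∘ g)) h ⟩
  distinct (r ∘ g) + (a + h)   ≡⟨ cong (distinct (r ∘ g) +_) head ⟩
  distinct (r ∘ g) + (h′ + b)  ≡⟨ +-assoc (distinct (r ∘ g)) h′ b ⟨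
  distinct (r ∘ g) + h′ + b    ≡⟨ cong (_+ b) (distinct-replace g x≢y) ⟩
  distinct g + b               ≡⟨ +-comm (distinct g) b ⟩
  b + distinct g               ∎
  where
  open ≡-Reasoning
  g = f ∘ suc
  r = replace x y
  a = ι (¬? (hits? (r ∘ g) (r (f zero))))
  b = ι (¬? (hits? g (f zero)))
  h = ι (hits? f x ×-dec hits? f y)
  h′ = ι (hits? g x ×-dec hits? g y)
  shuffle : ∀ p q s → p + q + s ≡ q + (p + s)
  shuffle = solve-∀
  there′ : ∀ {z} → Hits g z → Hits f z
  there′ (j , eq) = suc j , eq
  tail : ∀ {z} → f zero ≢ z → Hits f z → Hits g z
  tail ne (zero , eq)  = ⊥-elim (ne eq)
  tail ne (suc j , eq) = j , eq
  ⇔x : ∀ {z} → z ≡ x → ι (¬? (hits? (r ∘ g) z)) ≡ ι (¬? (hits? g x ⊎-dec hits? g y))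
  ⇔x refl = ι-cong (¬? (hits? (r ∘ g) x)) (¬? (hits? g x ⊎-dec hits? g y))
    (_∘ hits-replace⁺ g) (_∘ hits-replace⁻ g)
  caseˣ : ∀ {A B : Set} (p : Dec A) (q : Dec B) → ι (¬? (p ⊎-dec q)) + ι q ≡ ι (p ×-dec q) + ι (¬? p)
  caseˣ (yes _) (yes _) = refl
  caseˣ (yes _) (no _)  = refl
  caseˣ (no _)  (yes _) = refl
  caseˣ (no _)  (no _)  = refl
  caseʸ : ∀ {A B : Set} (p : Dec A) (q : Dec B) → ι (¬? (p ⊎-dec q)) + ι p ≡ ι (p ×-dec q) + ι (¬? q)
  caseʸ (yes _) (yes _) = refl
  caseʸ (yes _) (no _)  = refl
  caseʸ (no _)  (yes _) = refl
  caseʸ (no _)  (no _)  = refl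
  -- A head equal to `x` or `y` becomes `x`, which recurs after merging when either value recurs;
  -- `caseˣ` and `caseʸ` are the resulting identities. Any other head recurs exactly as before.
  head′ : Dec (f zero ≡ x) → Dec (f zero ≡ y) → a + h ≡ h′ + b
  head′ (yes p) (yes q) = ⊥-elim (x≢y (trans (sym p) q))
  head′ (yes p) (no ne) = trans (cong₂ _+_ (⇔x (trans (replace-≢ ne) p))
      (ι-cong (hits? f x ×-dec hits? f y) (hits? g y) (λ (_ , q) → tail ne q) (λ q → (zero , p) , there′ q)))
    (trans (caseˣ (hits? g x) (hits? g y)) (cong (λ z → h′ + ι (¬? (hits? g z))) (sym p)))
  head′ (no ne) (yes q) = trans (cong₂ _+_ (⇔x (replace-≡ q))
      (ι-cong (hits? f x ×-dec hits? f y) (hits? g x) (λ (p , _) → tail ne p) (λ p → there′ p , (zero , q))))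
    (trans (caseʸ (hits? g x) (hits? g y)) (cong (λ z → h′ + ι (¬? (hits? g z))) (sym q)))
  head′ (no ne₁) (no ne₂) = trans (+-comm a h) (cong₂ _+_
    (ι-cong (hits? f x ×-dec hits? f y) (hits? g x ×-dec hits? g y)
      (λ (p , q) → tail ne₁ p , tail ne₂ q) (λ (p , q) → there′ p , there′ q))
    (ι-cong (¬? (hits? (r ∘ g) (r (f zero)))) (¬? (hits? g (f zero)))
      (λ ¬p → λ { (j , eq) → ¬p (j , cong r eq) })
      (λ ¬p → λ { (j , eq) → ¬p (j , unreplace (trans eq (replace-≢ ne₂))) })))
    where
    unreplace : ∀ {z} → r z ≡ f zero → z ≡ f zero
    unreplace {z} eq with z ≟ y
    ... | yes _ = ⊥-elim (ne₁ (sym eq))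
    ... | no _  = eq
  head : a + h ≡ h′ + b
  head = head′ (f zero ≟ x) (f zero ≟ y)

-- Points outside the class of `x` contribute at most one value each, and the class itself at most
-- one more.
same-value-bound : (f : Fin n → Fin m) (x : Fin m) → ∑ (fins n) (λ j → ι (x ≟ f j)) + distinct f ≤ suc n
same-value-bound {zero}  f x = z≤n
same-value-bound {suc n} f x rewrite ∑-fins-suc n (λ j → ι (x ≟ f j)) = go (x ≟ f zero) (hits? g (f zero)) (same-value-bound g x)
  where
  g = f ∘ suc
  N = ∑ (fins n) (λ j → ι (x ≟ g j))
  d = distinct g
  shuffle : ∀ a b c e → a + b + (c + e) ≡ a + c + (b + e)
  shuffle = solve-∀
  absent : x ≡ f zero → ¬ Hits g (f zero) → N ≡ 0
  absent x≡ ¬hit = ∑-none (λ j → x ≟ g j) (fins n) (λ {j} _ eq → ¬hit (j , trans (sym eq) x≡))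
  go : (p : Dec (x ≡ f zero)) (q : Dec (Hits g (f zero))) → N + d ≤ suc n → ι p + N + (ι (¬? q) + d) ≤ suc (suc n)
  go (yes p) (yes q) ih = s≤s ih
  go (yes p) (no q)  ih rewrite absent p q = s≤s (s≤s (distinct≤n g))
  go (no p)  q       ih = ≤-trans (≤-reflexive (shuffle 0 N (ι (¬? q)) d)) (+-mono-≤ (ι≤1 (¬? q)) ih)

-- The extreme case is one class of `k` points beside singletons. A point that opens a new class
-- keeps `k` and adds no inner edge; one that joins a class raises `k` by one, and by
-- `same-value-bound` that class had at most the old `k` points.
edges-within-classes : (f : Fin n → Fin m) → distinct f + k ≡ suc n → ∑ (edges n) (λ e → ι (f (lo e) ≟ f (hi e))) ≤ tri k
edges-within-classes {zero}  f eq = z≤n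
edges-within-classes {suc n} {k = k} f eq rewrite ∑-edges-suc n (λ e → ι (f (lo e) ≟ f (hi e))) = go k (hits? g (f zero)) eq
  where
  g = f ∘ suc
  N = ∑ (fins n) (λ j → ι (f zero ≟ g j))
  R = ∑ (edges n) (λ e → ι (g (lo e) ≟ g (hi e)))
  absent : ¬ Hits g (f zero) → N ≡ 0
  absent ¬hit = ∑-none (λ j → f zero ≟ g j) (fins n) (λ {j} _ eq → ¬hit (j , sym eq))
  go : ∀ k (q : Dec (Hits g (f zero))) → ι (¬? q) + distinct g + k ≡ suc (suc n) → N + R ≤ tri k
  go k (no q) eq rewrite absent q = edges-within-classes g (cong pred eq)
  go zero (yes q) eq = ⊥-elim (<-irrefl (sym (trans (sym eq) (+-identityʳ _))) (s≤s (≤-trans (distinct≤n g) (n≤1+n n))))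
  go (suc k) (yes q) eq = +-mono-≤ N≤k (edges-within-classes g eq′)
    where
    eq′ : distinct g + k ≡ suc n
    eq′ = cong pred (trans (sym (+-suc (distinct g) k)) eq)
    N≤k : N ≤ k
    N≤k = +-cancelʳ-≤ (distinct g) N k (≤-trans (same-value-bound g (f zero)) (≤-reflexive (trans (sym eq′) (+-comm (distinct g) k))))

-- Connectivity of edge lists

merge : Edge n → (Fin n → Fin n) → Fin n → Fin n
merge e f v = replace (f (lo e)) (f (hi e)) (f v)

-- Vertices have equal labels exactly when they lie in the same component.
label : List (Edge n) → Fin n → Fin n
label []      = id
label (e ∷ l) = merge e (label l)

Linked : List (Edge n) → Edge n → Set
Linked l e = label l (lo e) ≡ label l (hi e)

linked? : (l : List (Edge n)) (e : Edge n) → Dec (Linked l e)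
linked? l e = label l (lo e) ≟ label l (hi e)

∈⇒linked : ∀ {l : List (Edge n)} {e} → e ∈ l → Linked l e
∈⇒linked {l = e ∷ l} (here refl) with label l (lo e) ≟ label l (hi e)
... | yes _ = sym (replace-≡ {z = label l (hi e)} refl)
... | no _  = sym (replace-≡ {z = label l (hi e)} refl)
∈⇒linked {l = e ∷ l} (there f∈) = cong (replace (label l (lo e)) (label l (hi e))) (∈⇒linked f∈)

-- Equality of labels is the least equivalence relation joining the ends of every edge. `R` will be
-- another labelling, the existence of a walk, or a vertex partition.
label-minimal : (R : Fin n → Fin n → Set) → (∀ {u} → R u u) → (∀ {u v} → R u v → R v u) →
  (∀ {u v w} → R u v → R v w → R u w) → ∀ l → (∀ {e} → e ∈ l → R (lo e) (hi e)) →
  ∀ u v → label l u ≡ label l v → R u v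
label-minimal R rf sy tr []      h u v refl = rf
label-minimal R rf sy tr (e ∷ l) h u v eq with label l u ≟ label l (hi e) | label l v ≟ label l (hi e)
... | yes p | yes q = label-minimal R rf sy tr l (h ∘ there) u v (trans p (sym q))
... | yes p | no _  = tr (label-minimal R rf sy tr l (h ∘ there) u (hi e) p)
                         (tr (sy (h (here refl))) (label-minimal R rf sy tr l (h ∘ there) (lo e) v eq))
... | no _  | yes q = tr (label-minimal R rf sy tr l (h ∘ there) u (lo e) eq)
                         (tr (h (here refl)) (label-minimal R rf sy tr l (h ∘ there) (hi e) v (sym q)))
... | no _  | no _  = label-minimal R rf sy tr l (h ∘ there) u v eq

infix 4 _⊑_
-- The closure order of the graphic matroid: `l` lies in the span of `l′` without having to be a
-- part of it. A list from which a colour was deleted can still be large in this order.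
record _⊑_ (l l′ : List (Edge n)) : Set where
  constructor within
  field linked : ∀ {e} → e ∈ l → Linked l′ e
open _⊑_

⊆⇒⊑ : ∀ {l l′ : List (Edge n)} → l ⊆ l′ → l ⊑ l′
⊆⇒⊑ l⊆ = within (∈⇒linked ∘ l⊆)

⊑-label : ∀ {l l′ : List (Edge n)} → l ⊑ l′ → ∀ u v → label l u ≡ label l v → label l′ u ≡ label l′ v
⊑-label {l = l} {l′} h = label-minimal (λ u v → label l′ u ≡ label l′ v) refl sym trans l (linked h)

++-⊑ : ∀ (m : List (Edge n)) {l l′} → l ⊑ l′ → m ++ l ⊑ m ++ l′
++-⊑ m {l} {l′} h = within λ e∈ → go (∈-++⁻ m e∈)
  where
  go : ∀ {e} → e ∈ m ⊎ e ∈ l → Linked (m ++ l′) e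
  go (inj₁ e∈m) = ∈⇒linked (∈-++⁺ˡ e∈m)
  go (inj₂ e∈l) = ⊑-label (⊆⇒⊑ (∈-++⁺ʳ m)) _ _ (linked h e∈l)

opaque
  components : List (Edge n) → ℕ
  components l = distinct (label l)

  components≡distinct : (l : List (Edge n)) → components l ≡ distinct (label l)
  components≡distinct l = refl

  components-anti : ∀ {l l′ : List (Edge n)} → l ⊑ l′ → components l′ ≤ components l
  components-anti h = distinct-anti (⊑-label h)

  components-[] : ∀ n → components {n} [] ≡ n
  components-[] n = distinct-id n

  1≤components : (l : List (Edge (suc n))) → 1 ≤ components l
  1≤components l = 1≤distinct (label l)

  components-constant : (l : List (Edge n)) → (∀ u v → label l u ≡ label l v) → components l ≤ 1
  components-constant l = distinct-constant (label l)

  components≤n : (l : List (Edge n)) → components l ≤ n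
  components≤n l = distinct≤n (label l)

components-linked : ∀ (l : List (Edge n)) e → Linked l e → components (e ∷ l) ≡ components l
components-linked l e h = ≤-antisym (components-anti {l = l} {e ∷ l} (⊆⇒⊑ there))
  (components-anti {l = e ∷ l} {l} (within λ { (here refl) → h ; (there f∈) → ∈⇒linked f∈ }))

opaque
  unfolding components

  components-unlinked : ∀ (l : List (Edge n)) e → ¬ Linked l e → suc (components (e ∷ l)) ≡ components l
  components-unlinked l e ¬h = trans (sym (+-comm _ 1)) (trans (cong (components (e ∷ l) +_) (sym both)) (distinct-replace (label l) ¬h))
    where
    both : ι (hits? (label l) (label l (lo e)) ×-dec hits? (label l) (label l (hi e))) ≡ 1
    both = ι-yes (hits? (label l) (label l (lo e)) ×-dec hits? (label l) (label l (hi e))) ((lo e , refl) , (hi e , refl))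

components-∷ : ∀ (l : List (Edge n)) e → components (e ∷ l) + ι (¬? (linked? l e)) ≡ components l
components-∷ l e with linked? l e
... | yes h = trans (+-identityʳ _) (components-linked l e h)
... | no ¬h = trans (+-comm _ 1) (components-unlinked l e ¬h)

components-∷-≤ : ∀ (l : List (Edge n)) e → components l ≤ suc (components (e ∷ l))
components-∷-≤ l e = ≤-trans (≤-reflexive (sym (components-∷ l e)))
  (≤-trans (+-monoʳ-≤ (components (e ∷ l)) (ι≤1 (¬? (linked? l e)))) (≤-reflexive (+-comm _ 1)))

components-++-≤ : ∀ (m l : List (Edge n)) → components l ≤ length m + components (m ++ l)
components-++-≤ []      l = ≤-refl
components-++-≤ (e ∷ m) l = ≤-trans (components-++-≤ m l)
  (≤-trans (+-monoʳ-≤ (length m) (components-∷-≤ (m ++ l) e)) (≤-reflexive (+-suc (length m) _)))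

-- Diminishing returns: an edge linked by `m ++ l` is also linked by `m ++ l′`, so adding `m` to the
-- larger span saves no more components.
components-marginal : ∀ (m : List (Edge n)) {l l′} → l ⊑ l′ →
  components (m ++ l) + components l′ ≤ components l + components (m ++ l′)
components-marginal []      h = ≤-refl
components-marginal (e ∷ m) {l} {l′} h with linked? (m ++ l) e
... | yes p rewrite components-linked (m ++ l) e p
                  | components-linked (m ++ l′) e (⊑-label (++-⊑ m h) _ _ p) = components-marginal m h
... | no ¬p = linear 0 (+-mono-≤ (components-marginal m h)
                (+-mono-≤ (components-∷-≤ (m ++ l′) e) (≤-reflexive (components-unlinked (m ++ l) e ¬p))))
                (shuffle (components (e ∷ m ++ l)) (components l′) (components l) (components (m ++ l′)) (components (e ∷ m ++ l′)) (components (m ++ l)))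
  where
  shuffle : ∀ a b c d e f → a + b + (c + d + (suc e + f)) + 0 ≡ c + e + (f + b + (d + suc a))
  shuffle = solve-∀

-- Submodularity of the graphic rank, as `components` is the number of vertices minus the rank. It
-- is diminishing returns for adding `Q` to `I` and to `P`; inclusions stand in for exact unions and
-- intersections of lists.
components-submodular : ∀ {I P Q U : List (Edge n)} → I ⊆ P → I ⊆ Q → U ⊆ Q ++ P →
  components P + components Q ≤ components U + components I
components-submodular {I = I} {P} {Q} {U} I⊆P I⊆Q U⊆ = begin
  components P + components Q           ≤⟨ +-monoʳ-≤ (components P) (components-anti (⊆⇒⊑ back)) ⟩
  components P + components (Q ++ I)    ≡⟨ +-comm (components P) _ ⟩
  components (Q ++ I) + components P    ≤⟨ components-marginal Q (⊆⇒⊑ I⊆P) ⟩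
  components I + components (Q ++ P)    ≤⟨ +-monoʳ-≤ (components I) (components-anti (⊆⇒⊑ U⊆)) ⟩
  components I + components U           ≡⟨ +-comm (components I) _ ⟩
  components U + components I           ∎
  where
  open ≤-Reasoning
  back : Q ++ I ⊆ Q
  back e∈ with ∈-++⁻ Q e∈
  ... | inj₁ p = p
  ... | inj₂ p = I⊆Q p

-- An added edge between two different labels would bring the count down to 0.
components-one : ∀ (l : List (Edge (suc n))) → components l ≤ 1 → ∀ u v → label l u ≡ label l v
components-one l le u v with u ≟ v
... | yes refl = refl
... | no u≢v with joining-edge u v u≢v
...   | e , j with linked? l e
...     | no ¬p = ⊥-elim (<-irrefl refl (≤-trans (s≤s (1≤components (e ∷ l))) (≤-trans (≤-reflexive (components-unlinked l e ¬p)) le)))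
components-one l le u v | no _ | e , inj₁ (refl , refl) | yes p = p
components-one l le u v | no _ | e , inj₂ (refl , refl) | yes p = sym p

-- Walks and spanning trees

walk-trans : ∀ {T : EdgeSet n} {u v w} → Walk T u v → Walk T v w → Walk T u w
walk-trans here       q = q
walk-trans (step a p) q = step a (walk-trans p q)

joins-sym : ∀ {e : Edge n} {u v} → Joins e u v → Joins e v u
joins-sym (inj₁ p) = inj₂ p
joins-sym (inj₂ p) = inj₁ p

walk-sym : ∀ {T : EdgeSet n} {u v} → Walk T u v → Walk T v u
walk-sym here                   = here
walk-sym (step (e , t , j) p) = walk-trans (walk-sym p) (step (e , t , joins-sym {e = e} j) here)

label⇒walk : ∀ {T : EdgeSet n} l → (∀ {e} → e ∈ l → T e) → ∀ u v → label l u ≡ label l v → Walk T u v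
label⇒walk {T = T} l h = label-minimal (Walk T) here walk-sym walk-trans l
  (λ {e} e∈ → step (e , h e∈ , inj₁ (refl , refl)) here)

joins⇒label : ∀ {l : List (Edge n)} {e u v} → Linked l e → Joins e u v → label l u ≡ label l v
joins⇒label p (inj₁ (refl , refl)) = p
joins⇒label p (inj₂ (refl , refl)) = sym p

walk⇒label : ∀ {T : EdgeSet n} {u v} → Walk T u v →
  Σ[ l ∈ List (Edge n) ] ((∀ {e} → e ∈ l → T e) × label l u ≡ label l v)
walk⇒label here = [] , (λ ()) , refl
walk⇒label (step (e , t , j) p) with walk⇒label p
... | l , h , eq = e ∷ l , (λ { (here refl) → t ; (there f∈) → h f∈ }) ,
  trans (joins⇒label {l = e ∷ l} {e} (∈⇒linked {l = e ∷ l} (here refl)) j) (⊑-label {l = l} {e ∷ l} (⊆⇒⊑ there) _ _ eq)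

-- An `EdgeSet` is an arbitrary predicate and cannot be enumerated or counted. The edges on chosen
-- walks from each vertex to `zero` form a finite connected part of it.
connected⇒list : ∀ {T : EdgeSet (suc n)} → Connected T →
  Σ[ l ∈ List (Edge (suc n)) ] ((∀ {e} → e ∈ l → T e) × components l ≤ 1)
connected⇒list {n} {T} conn with reach (fins (suc n))
  where
  reach : ∀ vs → Σ[ l ∈ List (Edge (suc n)) ] ((∀ {e} → e ∈ l → T e) × (∀ {v} → v ∈ vs → label l v ≡ label l zero))
  reach []       = [] , (λ ()) , λ ()
  reach (v ∷ vs) with walk⇒label (conn v zero) | reach vs
  ... | l , h , eq | l′ , h′ , eq′ = l ++ l′ , T-++ , eq-++
    where
    T-++ : ∀ {e} → e ∈ l ++ l′ → T e
    T-++ e∈ with ∈-++⁻ l e∈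
    ... | inj₁ p = h p
    ... | inj₂ p = h′ p
    eq-++ : ∀ {w} → w ∈ v ∷ vs → label (l ++ l′) w ≡ label (l ++ l′) zero
    eq-++ (here refl) = ⊑-label (⊆⇒⊑ {l = l} ∈-++⁺ˡ) _ _ eq
    eq-++ (there w∈)  = ⊑-label (⊆⇒⊑ (∈-++⁺ʳ l)) _ _ (eq′ w∈)
... | l , h , eq = l , h , components-constant l (λ u v → trans (eq (∈fins u)) (sym (eq (∈fins v))))

forest : List (Edge n) → List (Edge n)
forest [] = []
forest (e ∷ l) with linked? l e
... | yes _ = forest l
... | no _  = e ∷ forest l

forest⊆ : ∀ (l : List (Edge n)) → forest l ⊆ l
forest⊆ (e ∷ l) f∈ with linked? l e
forest⊆ (e ∷ l) f∈          | yes _ = there (forest⊆ l f∈)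
forest⊆ (e ∷ l) (here refl) | no _  = here refl
forest⊆ (e ∷ l) (there f∈)  | no _  = there (forest⊆ l f∈)

forest-⊒ : ∀ (l : List (Edge n)) → l ⊑ forest l
forest-⊒ [] = within λ ()
forest-⊒ (e ∷ l) with linked? l e
... | yes p = within λ { (here refl) → ⊑-label (forest-⊒ l) _ _ p ; (there f∈) → linked (forest-⊒ l) f∈ }
... | no _  = within λ { (here refl) → ∈⇒linked {l = e ∷ forest l} (here refl)
                       ; (there f∈) → ⊑-label {l′ = e ∷ forest l} (⊆⇒⊑ there) _ _ (linked (forest-⊒ l) f∈) }

components-forest : ∀ (l : List (Edge n)) → components (forest l) ≡ components l
components-forest l = ≤-antisym (components-anti (forest-⊒ l)) (components-anti (⊆⇒⊑ (forest⊆ l)))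

forest-size : ∀ (l : List (Edge n)) → components l + length (forest l) ≡ n
forest-size {n} [] = trans (+-identityʳ _) (components-[] n)
forest-size (e ∷ l) with linked? l e
... | yes p = trans (cong (_+ length (forest l)) (components-linked l e p)) (forest-size l)
... | no ¬p = trans (+-suc _ _) (trans (cong (_+ length (forest l)) (components-unlinked l e ¬p)) (forest-size l))

-- Counting: n ≤ components + length for every edge list, with equality for forests.
forest-irredundant : ∀ (l : List (Edge n)) m₁ m₂ {e} → forest l ≡ m₁ ++ e ∷ m₂ → ¬ Linked (m₁ ++ m₂) e
forest-irredundant {n} l m₁ m₂ {e} eq p = <-irrefl refl (begin-strict
  n                                              ≡⟨ components-[] n ⟨
  components {n} []                              ≤⟨ components-++-≤ (m₁ ++ m₂) [] ⟩
  length (m₁ ++ m₂) + components ((m₁ ++ m₂) ++ []) ≤⟨ +-monoʳ-≤ (length (m₁ ++ m₂)) (components-anti {l = m₁ ++ m₂} {(m₁ ++ m₂) ++ []} (⊆⇒⊑ ∈-++⁺ˡ)) ⟩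
  length (m₁ ++ m₂) + components (m₁ ++ m₂)      ≤⟨ +-monoʳ-≤ (length (m₁ ++ m₂)) (components-anti redundant) ⟩
  length (m₁ ++ m₂) + components (forest l)      <⟨ ≤-reflexive (cong (_+ components (forest l)) size) ⟩
  length (forest l) + components (forest l)      ≡⟨ +-comm (length (forest l)) _ ⟩
  components (forest l) + length (forest l)      ≡⟨ cong (_+ length (forest l)) (components-forest l) ⟩
  components l + length (forest l)               ≡⟨ forest-size l ⟩
  n                                              ∎)
  where
  open ≤-Reasoning
  size : suc (length (m₁ ++ m₂)) ≡ length (forest l)
  size = trans (cong suc (length-++ m₁)) (trans (sym (+-suc (length m₁) (length m₂))) (trans (sym (length-++ m₁)) (cong length (sym eq))))
  cases : ∀ {f} → f ∈ m₁ ⊎ f ∈ e ∷ m₂ → Linked (m₁ ++ m₂) f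
  cases (inj₁ f∈m₁)         = ∈⇒linked (∈-++⁺ˡ f∈m₁)
  cases (inj₂ (here refl))  = p
  cases (inj₂ (there f∈m₂)) = ∈⇒linked (∈-++⁺ʳ m₁ f∈m₂)
  redundant : forest l ⊑ m₁ ++ m₂
  redundant = within λ f∈ → cases (∈-++⁻ m₁ (subst (_ ∈_) eq f∈))

walk-label : ∀ {T : EdgeSet n} {u v} (l : List (Edge n)) → (∀ {e} → T e → Linked l e) → Walk T u v → label l u ≡ label l v
walk-label l h here                 = refl
walk-label l h (step (e , t , j) p) = trans (joins⇒label {l = l} {e} (h t) j) (walk-label l h p)

joins-other : ∀ {e : Edge n} {u v w} → Joins e u v → w ≢ u → w ≢ v → ¬ Incident w e
joins-other (inj₁ (refl , refl)) w≢u w≢v (inj₁ refl) = w≢u refl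
joins-other (inj₁ (refl , refl)) w≢u w≢v (inj₂ refl) = w≢v refl
joins-other (inj₂ (refl , refl)) w≢u w≢v (inj₁ refl) = w≢v refl
joins-other (inj₂ (refl , refl)) w≢u w≢v (inj₂ refl) = w≢u refl

chain-avoiding : ∀ {T : EdgeSet n} {u v w} xs → Chain T u xs v → w ≢ u → All (w ≢_) xs → w ≢ v →
  Walk (λ e → T e × ¬ Incident w e) u v
chain-avoiding []       (e , t , j)       w≢u w≢xs w≢v = step (e , (t , joins-other {e = e} j w≢u w≢v) , j) here
chain-avoiding (x ∷ xs) ((e , t , j) , c) w≢u (w≢x ∷ w≢xs) w≢v =
  step (e , (t , joins-other {e = e} j w≢u w≢x) , j) (chain-avoiding xs c w≢x w≢xs w≢v)

walk-map : ∀ {S T : EdgeSet n} {u v} → (∀ {e} → S e → T e) → Walk S u v → Walk T u v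
walk-map h here                 = here
walk-map h (step (e , s , j) p) = step (e , h s , j) (walk-map h p)

-- Cut the cycle at its first edge `f`, from `v₀` to `w₁`. The second edge differs from `f` because
-- its other end is not `v₀`; the rest never returns to `w₁` and so avoids `f`.
cycle⇒bypass : ∀ {T : EdgeSet n} → Cycle T →
  Σ[ f ∈ Edge n ] Σ[ u ∈ Fin n ] Σ[ v ∈ Fin n ] (T f × Joins f u v × Walk (λ e → T e × e ≢ f) v u)
cycle⇒bypass (v₀ , [] , () , _)
cycle⇒bypass (v₀ , _ ∷ [] , s≤s () , _)
cycle⇒bypass {T = T} (v₀ , w₁ ∷ w₂ ∷ ws , _ , ((v₀≢w₁ ∷ v₀≢w₂ ∷ v₀≢ws) ∷ (w₁≢w₂ ∷ w₁≢ws) ∷ _) , ((f , t , j) , (g , t′ , j′) , c)) =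
  f , v₀ , w₁ , t , j , step (g , (t′ , g≢f) , j′)
    (walk-map (λ (s , ¬inc) → s , λ { refl → ¬inc (joins⇒incident {e = f} (joins-sym {e = f} j)) })
              (chain-avoiding ws c w₁≢w₂ w₁≢ws (v₀≢w₁ ∘ sym)))
  where
  g≢f : g ≢ f
  g≢f refl = v₀≢w₂ (joins-injective {e = f} (joins-sym {e = f} j) j′)

-- The rest of a cycle links the ends of one of its edges without that edge, against
-- `forest-irredundant`.
forest-acyclic : ∀ (l : List (Edge n)) → ¬ Cycle (_∈ forest l)
forest-acyclic l cyc with cycle⇒bypass cyc
... | f , u , v , f∈ , j , p with ∈-∃++ f∈
...   | m₁ , m₂ , eq = forest-irredundant l m₁ m₂ eq (linked-f j (walk-label (m₁ ++ m₂) rest p))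
  where
  linked-f : Joins f u v → label (m₁ ++ m₂) v ≡ label (m₁ ++ m₂) u → Linked (m₁ ++ m₂) f
  linked-f (inj₁ (refl , refl)) q = sym q
  linked-f (inj₂ (refl , refl)) q = q
  rest : ∀ {e} → e ∈ forest l × e ≢ f → Linked (m₁ ++ m₂) e
  rest (e∈ , e≢f) with ∈-++⁻ m₁ (subst (_ ∈_) eq e∈)
  ... | inj₁ e∈m₁         = ∈⇒linked (∈-++⁺ˡ e∈m₁)
  ... | inj₂ (here refl)  = ⊥-elim (e≢f refl)
  ... | inj₂ (there e∈m₂) = ∈⇒linked (∈-++⁺ʳ m₁ e∈m₂)

forest-spanning : ∀ (l : List (Edge (suc n))) → components l ≤ 1 → SpanningTree (_∈ forest l)
forest-spanning l le = (λ u v → label⇒walk (forest l) id u v (components-one (forest l) le′ u v)) , forest-acyclic l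
  where
  le′ : components (forest l) ≤ 1
  le′ = ≤-trans (≤-reflexive (components-forest l)) le

-- Rado's deletion argument

x∉p-x : ∀ (p : Subset n) x → ¬ (x ∈ˢ p - x)
x∉p-x (_ Vec.∷ p) zero    ()
x∉p-x (_ Vec.∷ p) (suc x) (Vec.there x∈) = x∉p-x p x x∈

p-x⊆p : ∀ (p : Subset n) x {y} → y ∈ˢ p - x → y ∈ˢ p
p-x⊆p p x = p─q⊆p p _

size : Subset k → ℕ
size {k} J = ∑ (fins k) (λ a → ι (a ∈ˢ? J))

size≤ : ∀ (J : Subset k) → size J ≤ k
size≤ {k} J = ≤-trans (∑-mono (fins k) (λ a → ι≤1 (a ∈ˢ? J))) (≤-reflexive (trans (∑-one (fins k)) (length-fins k)))

size-⊤ : size (⊤ {k}) ≡ k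
size-⊤ {k} = trans (∑-cong (fins k) (λ a → ι-yes (a ∈ˢ? ⊤) ∈⊤)) (trans (∑-one (fins k)) (length-fins k))

size-remove : ∀ (J : Subset k) a → size J ≤ suc (size (J - a))
size-remove {k} J a = begin
  size J                                                      ≤⟨ ∑-mono (fins k) (λ b → ι-split (b ∈ˢ? J) (b ≟ a) (b ∈ˢ? (J - a)) (cases b)) ⟩
  ∑ (fins k) (λ b → ι (b ≟ a) + ι (b ∈ˢ? (J - a)))            ≡⟨ ∑-+ (fins k) _ _ ⟩
  ∑ (fins k) (λ b → ι (b ≟ a)) + size (J - a)                 ≤⟨ +-monoˡ-≤ _ (∑-≟ a) ⟩
  suc (size (J - a))                                          ∎
  where
  open ≤-Reasoning
  cases : ∀ b → b ∈ˢ J → b ≡ a ⊎ b ∈ˢ J - a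
  cases b b∈ with b ≟ a
  ... | yes eq = inj₁ eq
  ... | no ne  = inj₂ (x∈p∧x≢y⇒x∈p-y b∈ ne)

size-modular : ∀ (J₁ J₂ : Subset k) → size J₁ + size J₂ ≤ size (J₁ ∪ J₂) + size (J₁ ∩ J₂)
size-modular {k} J₁ J₂ = ≤-trans (≤-reflexive (sym (∑-+ (fins k) _ _)))
  (≤-trans (∑-mono (fins k) pointwise) (≤-reflexive (∑-+ (fins k) _ _)))
  where
  pointwise : ∀ a → ι (a ∈ˢ? J₁) + ι (a ∈ˢ? J₂) ≤ ι (a ∈ˢ? (J₁ ∪ J₂)) + ι (a ∈ˢ? (J₁ ∩ J₂))
  pointwise a with a ∈ˢ? J₁ | a ∈ˢ? J₂
  ... | no _  | no _  = z≤n
  ... | yes p | no _  = ≤-trans (≤-reflexive (sym (ι-yes (a ∈ˢ? (J₁ ∪ J₂)) (x∈p∪q⁺ (inj₁ p))))) (m≤m+n _ _)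
  ... | no _  | yes q = ≤-trans (≤-reflexive (sym (ι-yes (a ∈ˢ? (J₁ ∪ J₂)) (x∈p∪q⁺ (inj₂ q))))) (m≤m+n _ _)
  ... | yes p | yes q = ≤-reflexive (sym (cong₂ _+_ (ι-yes (a ∈ˢ? (J₁ ∪ J₂)) (x∈p∪q⁺ (inj₁ p)))
                                                    (ι-yes (a ∈ˢ? (J₁ ∩ J₂)) (x∈p∩q⁺ (p , q)))))

-- Here ν plays the role of a corank: Rado's condition is preserved when one of two
-- suitable sets of elements of the same colour is deleted, so it survives until every
-- colour is represented at most once.
module Rado {X : Set} {k : ℕ} (colour : X → Fin k) (ν : List X → ℕ)
  (submodular : ∀ {I P Q U} → I ⊆ P → I ⊆ Q → U ⊆ Q ++ P → ν P + ν Q ≤ ν U + ν I) (K : ℕ) where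

  restrict : Subset k → List X → List X
  restrict J = filter (λ x → colour x ∈ˢ? J)

  -- The defect form of Rado's condition: for ν = N - rank it says that the elements with colours in
  -- `J` have rank at least |J| - (K - N), so K - N is the permitted defect.
  Feasible : List X → Set
  Feasible S = ∀ J → ν (restrict J S) + size J ≤ K

  ν-anti : ∀ {U P} → U ⊆ P → ν P ≤ ν U
  ν-anti {U} {P} U⊆P = +-cancelʳ-≤ (ν P) (ν P) (ν U) (submodular {P} {P} {P} {U} id id (∈-++⁺ˡ ∘ U⊆P))

  restrict-⊆ : ∀ {J S S′} → S ⊆ S′ → restrict J S ⊆ restrict J S′
  restrict-⊆ S⊆ x∈ = let p , q = ∈-filter⁻ _ x∈ in ∈-filter⁺ _ (S⊆ p) q

  feasible-⊆ : ∀ {S S′} → S ⊆ S′ → Feasible S → Feasible S′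
  feasible-⊆ {S} {S′} S⊆ h J = ≤-trans (+-monoˡ-≤ (size J) (ν-anti {restrict J S} {restrict J S′} (restrict-⊆ {J} S⊆))) (h J)

  module _ {S S₁ S₂ : List X} (a : Fin k)
    (cover : ∀ {x} → x ∈ S → x ∈ S₁ ⊎ x ∈ S₂)
    (same : ∀ {x} → x ∈ S → colour x ≢ a → x ∈ S₁ × x ∈ S₂)
    (feasible : Feasible S) where

    private
      a∈violated : ∀ {S′} J → (∀ {x} → x ∈ S → colour x ≢ a → x ∈ S′) → K < ν (restrict J S′) + size J → a ∈ˢ J
      a∈violated {S′} J same′ viol with a ∈ˢ? J
      ... | yes a∈ = a∈
      ... | no a∉ = ⊥-elim (<⇒≱ viol (≤-trans (+-monoˡ-≤ (size J) (ν-anti {restrict J S} {restrict J S′} sub)) (feasible J)))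
        where
        sub : restrict J S ⊆ restrict J S′
        sub x∈ = let p , q = ∈-filter⁻ _ x∈ in ∈-filter⁺ _ (same′ p λ { refl → a∉ q }) q

    -- Suppose `J₁` violates the condition for `S₁` and `J₂` for `S₂`. Both must contain `a`, so the
    -- elements coloured in the union are covered by the two restrictions, and those coloured in the
    -- intersection without `a` lie in both. Submodularity then loses 1, for the colour `a`, while
    -- two strict violations amount to 2.
    exchange : Feasible S₁ ⊎ Feasible S₂
    exchange with anySubset? (λ J → K <? ν (restrict J S₁) + size J)
    ... | no ok = inj₁ (λ J → ≮⇒≥ (λ viol → ok (J , viol)))
    ... | yes (J₁ , viol₁) = inj₂ (λ J₂ → ≮⇒≥ (contra J₂))
      where
      contra : ∀ J₂ → ¬ (K < ν (restrict J₂ S₂) + size J₂)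
      contra J₂ viol₂ = <-irrefl refl (linear {L = suc (K + K)} {R = K + K} 0 (+-mono-≤ viol₁ (+-mono-≤ viol₂
          (+-mono-≤ (submodular I⊆R₁ I⊆R₂ U⊆R₂++R₁) (+-mono-≤ (size-modular J₁ J₂) (+-mono-≤ (size-remove (J₁ ∩ J₂) a)
          (+-mono-≤ (feasible (J₁ ∪ J₂)) (feasible (J₁ ∩ J₂ - a))))))))
          (shuffle K (ν R₁) (ν R₂) (ν U) (ν I) (size J₁) (size J₂) (size (J₁ ∪ J₂)) (size (J₁ ∩ J₂)) (size (J₁ ∩ J₂ - a))))
        where
        R₁ = restrict J₁ S₁
        R₂ = restrict J₂ S₂
        U = restrict (J₁ ∪ J₂) S
        I = restrict (J₁ ∩ J₂ - a) S
        a∈J₁ = a∈violated J₁ (λ x∈ ne → proj₁ (same x∈ ne)) viol₁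
        a∈J₂ = a∈violated J₂ (λ x∈ ne → proj₂ (same x∈ ne)) viol₂
        I⁻ : ∀ {x} → x ∈ I → (x ∈ S₁ × x ∈ S₂) × (colour x ∈ˢ J₁ × colour x ∈ˢ J₂)
        I⁻ x∈ = let p , q = ∈-filter⁻ _ x∈ in
          same p (λ { refl → x∉p-x (J₁ ∩ J₂) _ q }) , x∈p∩q⁻ J₁ J₂ (p-x⊆p (J₁ ∩ J₂) a q)
        I⊆R₁ : I ⊆ R₁
        I⊆R₁ x∈ = let (p , _) , (q , _) = I⁻ x∈ in ∈-filter⁺ _ p q
        I⊆R₂ : I ⊆ R₂
        I⊆R₂ x∈ = let (_ , p) , (_ , q) = I⁻ x∈ in ∈-filter⁺ _ p q
        place : ∀ {x} → x ∈ S → colour x ∈ˢ J₁ ⊎ colour x ∈ˢ J₂ → x ∈ R₁ ⊎ x ∈ R₂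
        place {x} x∈ q with colour x ≟ a
        place x∈ q | yes refl with cover x∈
        ... | inj₁ p = inj₁ (∈-filter⁺ _ p a∈J₁)
        ... | inj₂ p = inj₂ (∈-filter⁺ _ p a∈J₂)
        place x∈ (inj₁ q) | no ne = inj₁ (∈-filter⁺ _ (proj₁ (same x∈ ne)) q)
        place x∈ (inj₂ q) | no ne = inj₂ (∈-filter⁺ _ (proj₂ (same x∈ ne)) q)
        U⊆R₂++R₁ : U ⊆ R₂ ++ R₁
        U⊆R₂++R₁ x∈ with ∈-filter⁻ _ x∈
        ... | p , q with place p (x∈p∪q⁻ J₁ J₂ q)
        ...   | inj₁ r = ∈-++⁺ʳ R₂ r
        ...   | inj₂ r = ∈-++⁺ˡ r
        shuffle : ∀ K p q u i s₁ s₂ s₃ s₄ s₅ →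
          suc (K + K) + (p + s₁ + (q + s₂ + (u + i + (s₃ + s₄ + (suc s₅ + (K + K)))))) + 0
          ≡ K + K + (suc K + (suc K + (p + q + (s₁ + s₂ + (s₄ + (u + s₃ + (i + s₅)))))))
        shuffle = solve-∀

  ColourInjective : List X → Set
  ColourInjective S = ∀ {x y} → x ∈ S → y ∈ S → colour x ≡ colour y → x ≡ y

  transversal : ∀ S → Feasible S → Σ[ S′ ∈ List X ] (S′ ⊆ S × ColourInjective S′ × Feasible S′)
  transversal S feasible = go S [] (λ ()) (λ x∈ → x∈) (λ ()) (feasible-⊆ {S} ∈-++⁺ˡ feasible)
    where
    go : ∀ xs zs → ColourInjective zs → xs ⊆ S → zs ⊆ S → Feasible (xs ++ zs) →
         Σ[ S′ ∈ List X ] (S′ ⊆ S × ColourInjective S′ × Feasible S′)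
    go []       zs inj xs⊆ zs⊆ h = zs , zs⊆ , inj , h
    -- Either `x` is discarded, or it displaces whatever was kept of its colour.
    go (x ∷ xs) zs inj xs⊆ zs⊆ h = continue (exchange {x ∷ xs ++ zs} {xs ++ zs} {x ∷ xs ++ ws} (colour x) cover same h)
      where
      ws = filter (λ z → ¬? (colour z ≟ colour x)) zs
      cover : ∀ {y} → y ∈ x ∷ xs ++ zs → y ∈ xs ++ zs ⊎ y ∈ x ∷ xs ++ ws
      cover (here refl) = inj₂ (here refl)
      cover (there y∈)  = inj₁ y∈
      same : ∀ {y} → y ∈ x ∷ xs ++ zs → colour y ≢ colour x → y ∈ xs ++ zs × y ∈ x ∷ xs ++ ws
      same (here refl) ne = ⊥-elim (ne refl)
      same (there y∈)  ne with ∈-++⁻ xs y∈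
      ... | inj₁ p = y∈ , there (∈-++⁺ˡ p)
      ... | inj₂ p = y∈ , there (∈-++⁺ʳ xs (∈-filter⁺ _ p ne))
      ws⁻ : ∀ {y} → y ∈ ws → y ∈ zs × colour y ≢ colour x
      ws⁻ = ∈-filter⁻ _
      inj′ : ColourInjective (x ∷ ws)
      inj′ (here refl) (here refl) eq = refl
      inj′ (here refl) (there q)   eq = ⊥-elim (proj₂ (ws⁻ q) (sym eq))
      inj′ (there p)   (here refl) eq = ⊥-elim (proj₂ (ws⁻ p) eq)
      inj′ (there p)   (there q)   eq = inj (proj₁ (ws⁻ p)) (proj₁ (ws⁻ q)) eq
      ws⊆ : x ∷ ws ⊆ S
      ws⊆ (here refl) = xs⊆ (here refl)
      ws⊆ (there p)   = zs⊆ (proj₁ (ws⁻ p))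
      rotate : x ∷ xs ++ ws ⊆ xs ++ x ∷ ws
      rotate (here refl) = ∈-++⁺ʳ xs (here refl)
      rotate (there p) with ∈-++⁻ xs p
      ... | inj₁ q = ∈-++⁺ˡ q
      ... | inj₂ q = ∈-++⁺ʳ xs (there q)
      continue : Feasible (xs ++ zs) ⊎ Feasible (x ∷ xs ++ ws) → _
      continue (inj₁ h₁) = go xs zs inj (xs⊆ ∘ there) zs⊆ h₁
      continue (inj₂ h₂) = go xs (x ∷ ws) inj′ (xs⊆ ∘ there) ws⊆ (feasible-⊆ {x ∷ xs ++ ws} rotate h₂)

-- Extending t - 1 prescribed edges to t rainbow spanning trees

tri-+ : ∀ a b → tri (a + b) ≡ tri a + tri b + a * b
tri-+ zero    b = sym (+-identityʳ (tri b))
tri-+ (suc a) b = trans (cong (a + b +_) (tri-+ a b)) (shuffle a b (tri a) (tri b) (a * b))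
  where
  shuffle : ∀ a b x y z → a + b + (x + y + z) ≡ a + x + y + (b + z)
  shuffle = solve-∀

-- Convexity of `tri`: the slack is `a * b`, with equality when one class has just two vertices.
two-classes : ∀ a b → tri (2 + a) + tri (2 + b) ≤ suc (tri (2 + a + b))
two-classes a b rewrite tri-+ (2 + a) b = ≤-trans (m≤m+n _ (a * b)) (≤-reflexive (shuffle a b (tri a) (tri b) (a * b)))
  where
  shuffle : ∀ a b x y z → suc a + (a + x) + (suc b + (b + y)) + z ≡ suc (suc a + (a + x) + y + (b + (b + z)))
  shuffle = solve-∀

module _ {n k : ℕ} (c : Coloring n k) where

  remaining : List (Edge n) → List (Edge n)
  remaining A = filter (λ e → ¬? (e ∈? A)) (edges n)

  seen? : ∀ {B : Edge n → Set} → (∀ e → Dec (B e)) → ∀ A a → Dec (Any (λ e → B e × c e ≡ a) (remaining A))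
  seen? B? A a = Any.any? (λ e → B? e ×-dec (c e ≟ a)) (remaining A)

  palette : ∀ {B : Edge n → Set} → (∀ e → Dec (B e)) → List (Edge n) → ℕ
  palette B? A = ∑ (fins k) (λ a → ι (seen? B? A a))

  Full : List (Edge n) → Set
  Full A = ∀ a → Σ[ e ∈ Edge n ] (e ∈ remaining A × c e ≡ a)

-- `star` says that the colours of H and the prescribed edges at `v` together can serve t trees. In
-- `many`, `q + 3` is a number of components on the `suc n` vertices, and `tri (suc m)` is the
-- largest number of edges inside that many components.
module Extension {n k : ℕ} (c : Coloring (suc n) k) (A : List (Edge (suc n))) (A-unique : Unique A)
  (full : Full c A)
  (star : ∀ v → suc (length A) ≤ palette c (incident? v) A + ∑ A (ι ∘ incident? v))
  (many : ∀ q m → suc q + suc m ≡ n → suc (length A) * suc q + tri (suc m) < k) where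

  t : ℕ
  t = suc (length A)

  H : List (Edge (suc n))
  H = remaining c A

  H⁻ : ∀ {e} → e ∈ H → ¬ (e ∈ A)
  H⁻ e∈ = proj₂ (∈-filter⁻ (λ e → ¬? (e ∈? A)) {xs = edges (suc n)} e∈)

  coloured : Subset k → List (Edge (suc n))
  coloured J = filter (λ e → c e ∈ˢ? J) H

  coloured⁺ : ∀ {J e} → e ∈ H → c e ∈ˢ J → e ∈ coloured J
  coloured⁺ {J} = ∈-filter⁺ (λ e → c e ∈ˢ? J)

  coloured⁻ : ∀ {J e} → e ∈ coloured J → e ∈ H × c e ∈ˢ J
  coloured⁻ {J} = ∈-filter⁻ (λ e → c e ∈ˢ? J)

  base : Fin t → List (Edge (suc n))
  base zero    = []
  base (suc i) = lookup A i ∷ []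

  Allowed : Fin t → Edge (suc n) → Set
  Allowed zero    e = 𝟙
  Allowed (suc i) e = c e ≢ c (lookup A i)

  allowed? : ∀ i e → Dec (Allowed i e)
  allowed? zero    e = yes tt
  allowed? (suc i) e = ¬? (c e ≟ c (lookup A i))

  part : Fin t → Subset k → List (Edge (suc n))
  part i J = filter (allowed? i) (coloured J)

  part⁺ : ∀ {i J e} → e ∈ coloured J → Allowed i e → e ∈ part i J
  part⁺ {i} = ∈-filter⁺ (allowed? i)

  part⁻ : ∀ {i J e} → e ∈ part i J → e ∈ coloured J × Allowed i e
  part⁻ {i} = ∈-filter⁻ (allowed? i)

  corank : Subset k → Fin t → ℕ
  corank J i = components (base i ++ part i J)

  module _ (J : Subset k)
    (irredundant : ∀ {e} → e ∈ coloured J → Linked (coloured (J - c e)) e) where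

    private
      l = coloured J
      p = components l
      cut = ∑ A (λ a → ι (¬? (linked? l a)))
      uncut = ∑ A (λ a → ι (linked? l a))

      uncut+cut : uncut + cut ≡ length A
      uncut+cut = trans (sym (∑-+ A _ _)) (trans (∑-cong A (λ a → ι+ι¬ (linked? l a) (¬? (linked? l a)))) (∑-one A))

      -- `part (suc i) J` lacks the edges coloured like the reserved edge, but by `irredundant` the
      -- ends of each are linked through the other colours of J.
      part-⊒ : ∀ i → l ⊑ part i J
      part-⊒ zero    = ⊆⇒⊑ (λ e∈ → part⁺ {zero} e∈ tt)
      part-⊒ (suc i) = within go
        where
        smaller : coloured (J - c (lookup A i)) ⊆ part (suc i) J
        smaller e∈ = let p , q = coloured⁻ {J - c (lookup A i)} e∈ in
          part⁺ {suc i} (coloured⁺ {J} p (p-x⊆p J _ q)) (λ eq → x∉p-x J _ (subst (_∈ˢ J - c (lookup A i)) eq q))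
        go : ∀ {e} → e ∈ l → Linked (part (suc i) J) e
        go {e} e∈ with c e ≟ c (lookup A i)
        ... | no ne  = ∈⇒linked (part⁺ {suc i} e∈ ne)
        ... | yes eq = ⊑-label (⊆⇒⊑ smaller) _ _ (subst (λ a → Linked (coloured (J - a)) e) eq (irredundant e∈))

      corank-zero : corank J zero ≤ p
      corank-zero = components-anti {l = l} (part-⊒ zero)

      corank-suc : ∀ i → corank J (suc i) + ι (¬? (linked? l (lookup A i))) ≤ p
      corank-suc i = ≤-trans (+-monoˡ-≤ _ (components-anti {l = lookup A i ∷ l} (++-⊑ (lookup A i ∷ []) (part-⊒ (suc i)))))
                             (≤-reflexive (components-∷ l (lookup A i)))

      ∑-corank : ∑ (fins t) (corank J) + cut ≤ t * p
      ∑-corank = begin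
        ∑ (fins t) (corank J) + cut
          ≡⟨ cong₂ _+_ (∑-fins-suc (length A) (corank J)) (sym (∑-fins-lookup A (λ a → ι (¬? (linked? l a))))) ⟩
        corank J zero + ∑ (fins (length A)) (corank J ∘ suc) + ∑ (fins (length A)) (λ i → ι (¬? (linked? l (lookup A i))))
          ≡⟨ +-assoc (corank J zero) _ _ ⟩
        corank J zero + (∑ (fins (length A)) (corank J ∘ suc) + ∑ (fins (length A)) (λ i → ι (¬? (linked? l (lookup A i)))))
          ≡⟨ cong (corank J zero +_) (∑-+ (fins (length A)) _ _) ⟨
        corank J zero + ∑ (fins (length A)) (λ i → corank J (suc i) + ι (¬? (linked? l (lookup A i))))
          ≤⟨ +-mono-≤ corank-zero (∑-mono (fins (length A)) corank-suc) ⟩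
        p + ∑ (fins (length A)) (λ _ → p)
          ≡⟨ cong (p +_) (trans (∑-const (fins (length A)) p) (cong (_* p) (length-fins (length A)))) ⟩
        t * p ∎
        where open ≤-Reasoning

      inside : ℕ
      inside = ∑ (edges (suc n)) (λ e → ι (linked? l e))

      -- By `full` each colour of J has an edge in H, whose ends are then in one component of `l`.
      -- These edges are distinct from each other and, lying outside A, from the uncut prescribed
      -- edges.
      size+uncut : size J + uncut ≤ inside
      size+uncut = begin
        size J + uncut
          ≤⟨ +-mono-≤ colours prescribed ⟩
        ∑ (edges (suc n)) (λ e → ι (¬? (e ∈? A) ×-dec linked? l e)) + ∑ (edges (suc n)) (λ e → ι ((e ∈? A) ×-dec linked? l e))
          ≡⟨ ∑-+ (edges (suc n)) _ _ ⟨
        ∑ (edges (suc n)) (λ e → ι (¬? (e ∈? A) ×-dec linked? l e) + ι ((e ∈? A) ×-dec linked? l e))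
          ≤⟨ ∑-mono (edges (suc n)) (λ e → ι-disjoint (¬? (e ∈? A) ×-dec linked? l e) ((e ∈? A) ×-dec linked? l e) (linked? l e)
               proj₂ proj₂ (λ (p , _) (q , _) → p q)) ⟩
        inside ∎
        where
        open ≤-Reasoning
        colours : size J ≤ ∑ (edges (suc n)) (λ e → ι (¬? (e ∈? A) ×-dec linked? l e))
        colours = ∑-injection (_∈ˢ? J) (λ e → ¬? (e ∈? A) ×-dec linked? l e)
          (λ a e → (¬? (e ∈? A) ×-dec linked? l e) ×-dec (c e ≟ a)) (fins-unique k) (edges (suc n))
          (λ {a} _ a∈ → let e , e∈ , eq = full a in
            e , ∈edges e , (H⁻ e∈ , ∈⇒linked (coloured⁺ {J} e∈ (subst (_∈ˢ J) (sym eq) a∈))) , eq)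
          (λ _ → proj₁) (λ (_ , p) (_ , q) → trans (sym p) q)
        prescribed : uncut ≤ ∑ (edges (suc n)) (λ e → ι ((e ∈? A) ×-dec linked? l e))
        prescribed = ∑-injection (linked? l) (λ e → (e ∈? A) ×-dec linked? l e)
          (λ a e → ((e ∈? A) ×-dec linked? l e) ×-dec (a ≟ᴱ e)) A-unique (edges (suc n))
          (λ {a} a∈ q → a , ∈edges a , (a∈ , q) , refl) (λ _ → proj₁) (λ (_ , p) (_ , q) → trans p (sym q))

      -- An edge of H at `v` coloured in J would link `v`, so the palette at `v` is disjoint from J;
      -- and every prescribed edge at `v` is cut. Then `star` applies.
      isolated : ∀ v → (∀ w → w ≢ v → label l w ≢ label l v) → t + size J ≤ k + cut
      isolated v iso = linear 0 (+-mono-≤ (star v) (+-mono-≤ avoid deg))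
          (shuffle t (size J) k cut (palette c (incident? v) A) (∑ A (ι ∘ incident? v)))
        where
        shuffle : ∀ t s k x a d → t + s + (a + d + (k + x)) + 0 ≡ k + x + (t + (s + a + d))
        shuffle = solve-∀
        unlinked : ∀ {e} → Incident v e → ¬ Linked l e
        unlinked {e} (inj₁ refl) eq = iso (hi e) (λ q → <-irrefl (cong toℕ (sym q)) (lo<hi e)) (sym eq)
        unlinked {e} (inj₂ refl) eq = iso (lo e) (λ q → <-irrefl (cong toℕ q) (lo<hi e)) eq
        deg : ∑ A (ι ∘ incident? v) ≤ cut
        deg = ∑-mono A (λ a → ι-mono (incident? v a) (¬? (linked? l a)) (unlinked {a}))
        avoid : size J + palette c (incident? v) A ≤ k
        avoid = ≤-trans (≤-reflexive (sym (∑-+ (fins k) _ _)))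
          (≤-trans (∑-mono (fins k) (λ a → ι-disjoint (a ∈ˢ? J) (seen? c (incident? v) A a) (yes tt) _ _ (clash a)))
                   (≤-reflexive (trans (∑-one (fins k)) (length-fins k))))
          where
          clash : ∀ a → a ∈ˢ J → ¬ Any (λ e → Incident v e × c e ≡ a) H
          clash a a∈ seen with find seen
          ... | e , e∈ , inc , refl = unlinked {e} inc (∈⇒linked (coloured⁺ {J} e∈ a∈))

      -- Unless a component is a single vertex, both have at least two vertices, and `two-classes`
      -- bounds the inner edges by one more than those of a clique on all but two vertices.
      -- Strictness of `many 0` absorbs the one.
      two-components : p ≡ 2 → t + size J ≤ k + cut
      two-components p≡2 with any? (λ v → ¬? (label l v ≟ label l zero))
      ... | no same = ⊥-elim (<-irrefl refl (≤-trans (≤-reflexive (sym p≡2)) (components-constant l λ u v → trans (eq0 u) (sym (eq0 v)))))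
        where
        eq0 : ∀ u → label l u ≡ label l zero
        eq0 u with label l u ≟ label l zero
        ... | yes eq = eq
        ... | no ne  = ⊥-elim (same (u , ne))
      ... | yes (v , v≢) with any? (λ w → ¬? (w ≟ v) ×-dec ¬? (label l w ≟ label l zero))
      ...   | no alone = isolated v (λ w w≢v eq → alone (w , w≢v , λ eq′ → v≢ (trans (sym eq) eq′)))
      ...   | yes (w , w≢v , w≢) with any? (λ u → ¬? (u ≟ zero) ×-dec (label l u ≟ label l zero))
      ...     | no alone = isolated zero (λ u u≢0 eq → alone (u , u≢0 , eq))
      ...     | yes (u , u≢0 , u≡) = count (α ∸ 2) (β ∸ 2) (sym (m+[n∸m]≡n 2≤α)) (sym (m+[n∸m]≡n 2≤β))
        where
        near? = λ x → label l x ≟ label l zero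
        α = ∑ (fins (suc n)) (ι ∘ near?)
        β = ∑ (fins (suc n)) (λ x → ι (¬? (near? x)))
        2≤α : 2 ≤ α
        2≤α = ∑-two near? (∈fins u) (∈fins zero) u≢0 u≡ refl
        2≤β : 2 ≤ β
        2≤β = ∑-two (λ x → ¬? (near? x)) (∈fins w) (∈fins v) w≢v w≢ v≢
        α+β : α + β ≡ suc n
        α+β = count-complement near?
        inside≤ : inside ≤ tri α + tri β
        inside≤ = begin
          inside
            ≤⟨ ∑-mono (edges (suc n)) (λ e → ι-split (linked? l e) (near? (lo e) ×-dec near? (hi e))
                 (¬? (near? (lo e)) ×-dec ¬? (near? (hi e))) (cases e)) ⟩
          ∑ (edges (suc n)) (λ e → ι (near? (lo e) ×-dec near? (hi e)) + ι (¬? (near? (lo e)) ×-dec ¬? (near? (hi e))))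
            ≡⟨ ∑-+ (edges (suc n)) _ _ ⟩
          ∑ (edges (suc n)) (λ e → ι (near? (lo e) ×-dec near? (hi e))) + ∑ (edges (suc n)) (λ e → ι (¬? (near? (lo e)) ×-dec ¬? (near? (hi e))))
            ≡⟨ cong₂ _+_ (edges-inside near?) (edges-inside (λ x → ¬? (near? x))) ⟩
          tri α + tri β ∎
          where
          open ≤-Reasoning
          cases : ∀ e → Linked l e → (label l (lo e) ≡ label l zero × label l (hi e) ≡ label l zero)
                                   ⊎ (label l (lo e) ≢ label l zero × label l (hi e) ≢ label l zero)
          cases e eq with near? (lo e)
          ... | yes q = inj₁ (q , trans (sym eq) q)
          ... | no q  = inj₂ (q , λ q′ → q (trans eq q′))
        count : ∀ a b → α ≡ 2 + a → β ≡ 2 + b → t + size J ≤ k + cut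
        count a b αeq βeq = ≤-trans (linear uncut (+-mono-≤ (many 0 (suc (a + b)) n-eq) (+-mono-≤ size+uncut
            (+-mono-≤ (≤-trans inside≤ (≤-reflexive (cong₂ _+_ (cong tri αeq) (cong tri βeq)))) (two-classes a b))))
            (shuffle t (size J) k uncut inside (tri (2 + a)) (tri (2 + b)) (tri (2 + a + b)))) (m≤m+n k cut)
          where
          n-eq : 1 + suc (suc (a + b)) ≡ n
          n-eq = cong pred (trans (sym (shuffle′ a b)) (trans (sym (cong₂ _+_ αeq βeq)) α+β))
            where
            shuffle′ : ∀ a b → 2 + a + (2 + b) ≡ 4 + (a + b)
            shuffle′ = solve-∀
          shuffle : ∀ t s k u i x y z → t + s + (k + (i + (x + y + suc z))) + u ≡ k + (suc (t * 1 + z) + (s + u + (i + (x + y))))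
          shuffle = solve-∀

      bound : ∀ q → p ≡ q → t * p + size J ≤ k + t + cut
      bound zero eq = ⊥-elim (<-irrefl (sym eq) (1≤components l))
      bound (suc zero) eq rewrite eq = ≤-trans (linear 0 (size≤ J) (shuffle t (size J) k)) (m≤m+n (k + t) cut)
        where
        shuffle : ∀ t s k → t * 1 + s + k + 0 ≡ k + t + s
        shuffle = solve-∀
      bound (suc (suc zero)) eq rewrite eq = linear 0 (two-components eq) (shuffle t (size J) k cut)
        where
        shuffle : ∀ t s k x → t * 2 + s + (k + x) + 0 ≡ k + t + x + (t + s)
        shuffle = solve-∀
      -- Of the t(q + 3) on the left, `many` pays for t(q + 1) and one t stands on the right. The
      -- last t is 1 + `uncut` + `cut`: the 1 is the strictness of `many`, `uncut` is saved in
      -- `size+uncut`, and `cut` is on the right.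
      bound (suc (suc (suc q))) eq with m≤n⇒∃[o]m+o≡n (≤-trans (≤-reflexive (sym eq)) (components≤n l))
      ... | m , m-eq rewrite eq = linear 0 (+-mono-≤ (many q m (trans (cong suc (+-suc q m)) (cong pred m-eq)))
                (+-mono-≤ (≤-trans size+uncut inside≤) (≤-reflexive (sym uncut+cut))))
                (shuffle (length A) q (size J) k uncut cut (tri (suc m)))
        where
        inside≤ : inside ≤ tri (suc m)
        inside≤ = edges-within-classes (label l) (trans (cong (_+ suc m) (trans (sym (components≡distinct l)) eq)) (trans (+-suc _ m) (cong suc m-eq)))
        shuffle : ∀ s q j k u x w → suc s * (3 + q) + j + (k + (w + (u + x))) + 0
                  ≡ k + suc s + x + (suc (suc s * suc q + w) + (j + u + s))
        shuffle = solve-∀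

    irredundant⇒rado : ∑ (fins t) (corank J) + size J ≤ k + t
    irredundant⇒rado = linear 0 (+-mono-≤ ∑-corank (bound p refl))
        (shuffle (∑ (fins t) (corank J)) (size J) k t cut (t * p))
      where
      shuffle : ∀ r s k t x y → r + s + (y + (k + t + x)) + 0 ≡ k + t + (r + x + (y + s))
      shuffle = solve-∀

  -- A colour whose removal separates the ends of one of its edges in `coloured J` can be
  -- dropped from J: the left side of the condition does not decrease.
  rado : ∀ J → ∑ (fins t) (corank J) + size J ≤ k + t
  rado J = go J (⊂-wellFounded J)
    where
    go : ∀ J → Acc _⊂_ J → ∑ (fins t) (corank J) + size J ≤ k + t
    go J (acc rec) with Any.any? (λ e → ¬? (linked? (coloured (J - c e)) e)) (coloured J)
    ... | no none = irredundant⇒rado J irr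
      where
      irr : ∀ {e} → e ∈ coloured J → Linked (coloured (J - c e)) e
      irr {e} e∈ with linked? (coloured (J - c e)) e
      ... | yes p = p
      ... | no ¬p = ⊥-elim (none (lose e∈ ¬p))
    ... | yes some with find some
    ...   | e , e∈ , ¬p = linear 0 (+-mono-≤ (go (J - c e) (rec (x∈p⇒p-x⊂p (proj₂ (coloured⁻ {J} e∈)))))
              (+-mono-≤ (size-remove J (c e)) drop-corank))
              (shuffle (∑ (fins t) (corank J)) (size J) (k + t) (∑ (fins t) (corank (J - c e))) (size (J - c e)))
      where
      J′ = J - c e
      shuffle : ∀ r s K r′ s′ → r + s + (K + (suc s′ + r′)) + 0 ≡ K + (r′ + s′ + (s + suc r))
      shuffle = solve-∀
      mono : ∀ i → part i J′ ⊆ part i J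
      mono i f∈ = let p , q = part⁻ {i} {J′} f∈ ; p₁ , p₂ = coloured⁻ {J′} p in part⁺ {i} (coloured⁺ {J} p₁ (p-x⊆p J (c e) p₂)) q
      -- Tree `zero` has neither a reserved edge nor a forbidden colour, so the separated edge
      -- itself is available to it. Its gain of a component pays for the lost colour; the other
      -- trees only need monotonicity.
      separated : suc (corank J zero) ≤ corank J′ zero
      separated = begin
        suc (components (part zero J))            ≤⟨ s≤s (components-anti {l = e ∷ coloured J′} {part zero J} (⊆⇒⊑ sub)) ⟩
        suc (components (e ∷ coloured J′))        ≡⟨ components-unlinked (coloured J′) e ¬p ⟩
        components (coloured J′)                  ≤⟨ components-anti {l = part zero J′} {coloured J′} (⊆⇒⊑ (λ f∈ → proj₁ (part⁻ {zero} {J′} f∈))) ⟩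
        components (part zero J′)                 ∎
        where
        open ≤-Reasoning
        sub : e ∷ coloured J′ ⊆ part zero J
        sub (here refl) = part⁺ {zero} {J} e∈ tt
        sub (there f∈)  = let p₁ , p₂ = coloured⁻ {J′} f∈ in part⁺ {zero} (coloured⁺ {J} p₁ (p-x⊆p J (c e) p₂)) tt
      drop-corank : suc (∑ (fins t) (corank J)) ≤ ∑ (fins t) (corank J′)
      drop-corank = begin
        suc (∑ (fins t) (corank J))                                        ≡⟨ cong suc (∑-fins-suc (length A) (corank J)) ⟩
        suc (corank J zero) + ∑ (fins (length A)) (corank J ∘ suc)         ≤⟨ +-mono-≤ separated (∑-mono (fins (length A)) λ i →
            components-anti {l = base (suc i) ++ part (suc i) J′} {base (suc i) ++ part (suc i) J} (++-⊑ (base (suc i)) (⊆⇒⊑ (mono (suc i))))) ⟩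
        corank J′ zero + ∑ (fins (length A)) (corank J′ ∘ suc)             ≡⟨ ∑-fins-suc (length A) (corank J′) ⟨
        ∑ (fins t) (corank J′)                                             ∎
        where open ≤-Reasoning

  -- The ground set of the direct sum of t graphic matroids: an edge with the tree it is offered to.
  -- All copies of an edge share its colour, so distinct colours also keep an edge out of two trees.
  Element : Set
  Element = Edge (suc n) × Fin t

  slice : Fin t → List Element → List (Edge (suc n))
  slice i S = map proj₁ (filter (λ x → proj₂ x ≟ i) S)

  slice⁺ : ∀ {i S e} → (e , i) ∈ S → e ∈ slice i S
  slice⁺ {i} x∈ = ∈-map⁺ proj₁ (∈-filter⁺ (λ x → proj₂ x ≟ i) x∈ refl)

  slice⁻ : ∀ {i S e} → e ∈ slice i S → (e , i) ∈ S
  slice⁻ {i} {S} e∈ with ∈-map⁻ proj₁ e∈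
  ... | x , x∈ , refl with ∈-filter⁻ (λ x → proj₂ x ≟ i) {xs = S} x∈
  ...   | p , refl = p

  component-count : List Element → Fin t → ℕ
  component-count S i = components (base i ++ slice i S)

  total : List Element → ℕ
  total S = ∑ (fins t) (component-count S)

  total-submodular : ∀ {I P Q U} → I ⊆ P → I ⊆ Q → U ⊆ Q ++ P → total P + total Q ≤ total U + total I
  total-submodular {I} {P} {Q} {U} I⊆P I⊆Q U⊆ = ≤-trans (≤-reflexive (sym (∑-+ (fins t) (component-count P) (component-count Q))))
      (≤-trans (∑-mono (fins t) pointwise) (≤-reflexive (∑-+ (fins t) (component-count U) (component-count I))))
    where
    lift : ∀ i {S S′} → S ⊆ S′ → base i ++ slice i S ⊆ base i ++ slice i S′
    lift i {S} {S′} S⊆ e∈ with ∈-++⁻ (base i) e∈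
    ... | inj₁ p = ∈-++⁺ˡ p
    ... | inj₂ p = ∈-++⁺ʳ (base i) (slice⁺ {S = S′} (S⊆ (slice⁻ {S = S} p)))
    cover : ∀ i → base i ++ slice i U ⊆ (base i ++ slice i Q) ++ (base i ++ slice i P)
    cover i e∈ with ∈-++⁻ (base i) e∈
    ... | inj₁ p = ∈-++⁺ˡ (∈-++⁺ˡ p)
    ... | inj₂ p with ∈-++⁻ Q (U⊆ (slice⁻ {S = U} p))
    ...   | inj₁ q = ∈-++⁺ˡ (∈-++⁺ʳ (base i) (slice⁺ q))
    ...   | inj₂ q = ∈-++⁺ʳ (base i ++ slice i Q) (∈-++⁺ʳ (base i) (slice⁺ q))
    pointwise : ∀ i → component-count P i + component-count Q i ≤ component-count U i + component-count I i
    pointwise i = components-submodular {I = base i ++ slice i I} {base i ++ slice i P} {base i ++ slice i Q} {base i ++ slice i U}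
      (lift i I⊆P) (lift i I⊆Q) (cover i)

  elements : List Element
  elements = filter (λ (e , i) → allowed? i e) (cartesianProduct H (fins t))

  -- With the constant `k + t`, feasibility at `⊤` says that the component counts of the t trees sum
  -- to at most t.
  open Rado {Element} (c ∘ proj₁) total total-submodular (k + t)

  elements-feasible : Feasible elements
  elements-feasible J = ≤-trans (+-monoˡ-≤ (size J) (∑-mono (fins t) λ i →
      components-anti {l = base i ++ part i J} {base i ++ slice i (restrict J elements)} (++-⊑ (base i) (⊆⇒⊑ (sub i))))) (rado J)
    where
    sub : ∀ i → part i J ⊆ slice i (restrict J elements)
    sub i e∈ = let p , q = part⁻ {i} {J} e∈ ; p₁ , p₂ = coloured⁻ {J} p in
      slice⁺ {i} (∈-filter⁺ (λ x → c (proj₁ x) ∈ˢ? J) (∈-filter⁺ (λ (e , i) → allowed? i e) (∈-cartesianProduct⁺ p₁ (∈fins i)) q) p₂)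

  -- The transversal makes every `edges-of i` connected; passing to a forest removes surplus edges,
  -- which cannot hurt rainbowness or disjointness.
  rainbow-trees : HasRainbowTrees t c
  rainbow-trees with transversal elements elements-feasible
  ... | S , S⊆ , inj , feasible = (λ i → _∈ tree i) , spanning , rainbow , disjoint
    where
    edges-of : Fin t → List (Edge (suc n))
    edges-of i = base i ++ slice i S
    tree : Fin t → List (Edge (suc n))
    tree i = forest (edges-of i)
    total≤ : total S ≤ length (fins t)
    total≤ = +-cancelʳ-≤ k _ _ (begin
      total S + k                                 ≤⟨ +-monoˡ-≤ k (ν-anti {restrict ⊤ S} {S} (λ x∈ → proj₁ (∈-filter⁻ (λ x → c (proj₁ x) ∈ˢ? ⊤) {xs = S} x∈))) ⟩
      total (restrict ⊤ S) + k                    ≡⟨ cong (total (restrict ⊤ S) +_) size-⊤ ⟨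
      total (restrict ⊤ S) + size (⊤ {k})         ≤⟨ feasible ⊤ ⟩
      k + t                                       ≡⟨ +-comm k t ⟩
      t + k                                       ≡⟨ cong (_+ k) (length-fins t) ⟨
      length (fins t) + k                         ∎)
      where open ≤-Reasoning
    spanning : ∀ i → SpanningTree (_∈ tree i)
    spanning i = forest-spanning (edges-of i) (∑-tight (fins t) (component-count S) (λ i → 1≤components (edges-of i)) total≤ (∈fins i))
    element : ∀ {e i} → e ∈ slice i S → e ∈ H × Allowed i e
    element {e} {i} e∈ = let p , q = ∈-filter⁻ (λ (e , i) → allowed? i e) {xs = cartesianProduct H (fins t)} (S⊆ (slice⁻ {S = S} e∈)) in
      proj₁ (∈-cartesianProduct⁻ H (fins t) p) , q
    rainbow-list : ∀ i {e f} → e ∈ edges-of i → f ∈ edges-of i → c e ≡ c f → e ≡ f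
    rainbow-list zero    p q eq = cong proj₁ (inj (slice⁻ {S = S} p) (slice⁻ {S = S} q) eq)
    rainbow-list (suc i) (here refl) (here refl) eq = refl
    rainbow-list (suc i) (here refl) (there q)   eq = ⊥-elim (proj₂ (element q) (sym eq))
    rainbow-list (suc i) (there p)   (here refl) eq = ⊥-elim (proj₂ (element p) eq)
    rainbow-list (suc i) (there p)   (there q)   eq = cong proj₁ (inj (slice⁻ {S = S} p) (slice⁻ {S = S} q) eq)
    rainbow : ∀ i → Rainbow c (_∈ tree i)
    rainbow i e f p q eq with rainbow-list i (forest⊆ (edges-of i) p) (forest⊆ (edges-of i) q) eq
    ... | refl = refl , refl
    split : ∀ i {e} → e ∈ edges-of i → (Σ[ j ∈ Fin (length A) ] (i ≡ suc j × e ≡ lookup A j)) ⊎ e ∈ slice i S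
    split zero    p           = inj₂ p
    split (suc i) (here refl) = inj₁ (i , refl , refl)
    split (suc i) (there p)   = inj₂ p
    same-tree : ∀ i j {e} → e ∈ edges-of i → e ∈ edges-of j → i ≡ j
    same-tree i j p q with split i p | split j q
    ... | inj₁ (i′ , refl , refl) | inj₁ (j′ , refl , eq) = cong suc (lookup-injective A-unique eq)
    ... | inj₁ (i′ , refl , refl) | inj₂ q′               = ⊥-elim (H⁻ (proj₁ (element q′)) (∈-lookup {xs = A} i′))
    ... | inj₂ p′                 | inj₁ (j′ , refl , refl) = ⊥-elim (H⁻ (proj₁ (element p′)) (∈-lookup {xs = A} j′))
    ... | inj₂ p′                 | inj₂ q′               = cong proj₂ (inj (slice⁻ {S = S} p′) (slice⁻ {S = S} q′) refl)
    disjoint : ∀ i j → i ≢ j → EdgeDisjoint (_∈ tree i) (_∈ tree j)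
    disjoint i j i≢j e p q = i≢j (same-tree i j (forest⊆ (edges-of i) p) (forest⊆ (edges-of j) q))

-- Choosing the prescribed edges

module Greedy {n k : ℕ} (c : Coloring n k) where

  remaining⁺ : ∀ {A e} → ¬ (e ∈ A) → e ∈ remaining c A
  remaining⁺ {A} {e} = ∈-filter⁺ (λ e → ¬? (e ∈? A)) (∈edges e)

  remaining⁻ : ∀ {A e} → e ∈ remaining c A → ¬ (e ∈ A)
  remaining⁻ {A} e∈ = proj₂ (∈-filter⁻ (λ e → ¬? (e ∈? A)) {xs = edges n} e∈)

  degree : Fin n → List (Edge n) → ℕ
  degree v A = ∑ A (ι ∘ incident? v)

  -- Limits the tree edges obtainable at `v`: each colour of H once, and each prescribed edge once.
  supply : List (Edge n) → Fin n → ℕ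
  supply A v = palette c (incident? v) A + degree v A

  Repeated : (Edge n → Set) → List (Edge n) → Set
  Repeated B A = Σ[ e ∈ Edge n ] Σ[ f ∈ Edge n ] (e ∈ remaining c A × f ∈ remaining c A × e ≢ f × c e ≡ c f × B e × B f)

  -- Pigeonhole: if the colours of the remaining `B`-edges were all different, the palette and the
  -- chosen edges would account for every `B`-edge.
  repeated : ∀ {B : Edge n → Set} (B? : ∀ e → Dec (B e)) A →
    palette c B? A + ∑ A (ι ∘ B?) < ∑ (edges n) (ι ∘ B?) → Repeated B A
  repeated {B} B? A lt with Any.any? (λ e → Any.any? (λ f → ¬? (e ≟ᴱ f) ×-dec ((c e ≟ c f) ×-dec (B? e ×-dec B? f))) (remaining c A)) (remaining c A)
  ... | yes some with find some
  ...   | e , e∈ , some′ with find some′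
  ...     | f , f∈ , e≢f , ceq , be , bf = e , f , e∈ , f∈ , e≢f , ceq , be , bf
  repeated {B} B? A lt | no none = ⊥-elim (<⇒≱ lt (begin
      ∑ (edges n) (ι ∘ B?)
        ≤⟨ ∑-mono (edges n) (λ e → ι-split (B? e) (¬? (e ∈? A) ×-dec B? e) ((e ∈? A) ×-dec B? e) (cases e)) ⟩
      ∑ (edges n) (λ e → ι (¬? (e ∈? A) ×-dec B? e) + ι ((e ∈? A) ×-dec B? e))
        ≡⟨ ∑-+ (edges n) _ _ ⟩
      ∑ (edges n) (λ e → ι (¬? (e ∈? A) ×-dec B? e)) + ∑ (edges n) (λ e → ι ((e ∈? A) ×-dec B? e))
        ≤⟨ +-mono-≤ outer inner ⟩
      palette c B? A + ∑ A (ι ∘ B?) ∎))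
    where
    open ≤-Reasoning
    cases : ∀ e → B e → (¬ (e ∈ A) × B e) ⊎ (e ∈ A × B e)
    cases e b with e ∈? A
    ... | yes p = inj₂ (p , b)
    ... | no p  = inj₁ (p , b)
    outer : ∑ (edges n) (λ e → ι (¬? (e ∈? A) ×-dec B? e)) ≤ palette c B? A
    outer = ∑-injection (λ e → ¬? (e ∈? A) ×-dec B? e) (seen? c B? A) (λ e a → (¬? (e ∈? A) ×-dec B? e) ×-dec (c e ≟ a))
      (edges-unique n) (fins k) (λ {e} _ p → c e , ∈fins (c e) , p , refl)
      (λ { {e} _ ((p , b) , refl) → lose (remaining⁺ {A} p) (b , refl) })
      inj
      where
      inj : ∀ {e f a} → (¬ (e ∈ A) × B e) × c e ≡ a → (¬ (f ∈ A) × B f) × c f ≡ a → e ≡ f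
      inj {e} {f} ((p , be) , eq) ((q , bf) , eq′) with e ≟ᴱ f
      ... | yes r = r
      ... | no r  = ⊥-elim (none (lose (remaining⁺ {A} p) (lose (remaining⁺ {A} q) (r , trans eq (sym eq′) , be , bf))))
    inner : ∑ (edges n) (λ e → ι ((e ∈? A) ×-dec B? e)) ≤ ∑ A (ι ∘ B?)
    inner = ∑-injection (λ e → (e ∈? A) ×-dec B? e) B? (λ e f → B? f ×-dec (e ≟ᴱ f)) (edges-unique n) A
      (λ {e} _ (p , b) → e , p , b , refl) (λ _ → proj₁) (λ (_ , p) (_ , q) → trans p (sym q))

  remaining-∷ : ∀ {A e f} → f ∈ remaining c A → f ≢ e → f ∈ remaining c (e ∷ A)
  remaining-∷ {A} {e} f∈ f≢e = remaining⁺ {e ∷ A} λ { (here eq) → f≢e eq ; (there p) → remaining⁻ {A} f∈ p }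

  full-∷ : ∀ {A} → Full c A → ∀ {e f} → f ∈ remaining c A → e ≢ f → c e ≡ c f → Full c (e ∷ A)
  full-∷ {A} full {e} {f} f∈ e≢f ceq a with full a
  ... | g , g∈ , eq with g ≟ᴱ e
  ...   | yes refl = f , remaining-∷ {A} f∈ (e≢f ∘ sym) , trans (sym ceq) eq
  ...   | no ne    = g , remaining-∷ {A} g∈ ne , eq

  -- Moving `e` into A can cost `v` only the colour of `e`, and only if `e` meets `v`; the degree
  -- then rises by one in return.
  supply-mono : ∀ A e v → supply A v ≤ supply (e ∷ A) v
  supply-mono A e v = begin
    palette c (incident? v) A + degree v A
      ≤⟨ +-monoˡ-≤ (degree v A) (∑-mono (fins k) (λ a → ι-split (seen? c (incident? v) A a) (seen? c (incident? v) (e ∷ A) a)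
           (incident? v e ×-dec (c e ≟ a)) (cases a))) ⟩
    ∑ (fins k) (λ a → ι (seen? c (incident? v) (e ∷ A) a) + ι (incident? v e ×-dec (c e ≟ a))) + degree v A
      ≡⟨ cong (_+ degree v A) (∑-+ (fins k) _ _) ⟩
    palette c (incident? v) (e ∷ A) + ∑ (fins k) (λ a → ι (incident? v e ×-dec (c e ≟ a))) + degree v A
      ≤⟨ +-monoˡ-≤ (degree v A) (+-monoʳ-≤ (palette c (incident? v) (e ∷ A))
           (∑-atMostOne (λ a → incident? v e ×-dec (c e ≟ a)) (incident? v e) (fins-unique k) (λ _ → proj₁) (λ { _ _ (_ , refl) (_ , refl) → refl }))) ⟩
    palette c (incident? v) (e ∷ A) + ι (incident? v e) + degree v A
      ≡⟨ +-assoc (palette c (incident? v) (e ∷ A)) _ _ ⟩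
    supply (e ∷ A) v ∎
    where
    open ≤-Reasoning
    cases : ∀ a → Any (λ f → Incident v f × c f ≡ a) (remaining c A) →
            Any (λ f → Incident v f × c f ≡ a) (remaining c (e ∷ A)) ⊎ (Incident v e × c e ≡ a)
    cases a seen with find seen
    ... | f , f∈ , inc , eq with f ≟ᴱ e
    ...   | yes refl = inj₂ (inc , eq)
    ...   | no ne    = inj₁ (lose (remaining-∷ {A} f∈ ne) (inc , eq))

  -- As `f` keeps the colour of `e` visible at `v`, the palette stays and the degree is pure gain.
  supply-strict : ∀ A {e f} v → f ∈ remaining c A → e ≢ f → c e ≡ c f → Incident v e → Incident v f →
    suc (supply A v) ≤ supply (e ∷ A) v
  supply-strict A {e} {f} v f∈ e≢f ceq ve vf = ≤-trans (≤-reflexive (sym (+-suc _ _)))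
      (+-mono-≤ (∑-mono (fins k) (λ a → ι-mono (seen? c (incident? v) A a) (seen? c (incident? v) (e ∷ A) a) (keep a)))
                (≤-reflexive (sym (cong (_+ degree v A) (ι-yes (incident? v e) ve)))))
    where
    keep : ∀ a → Any (λ f → Incident v f × c f ≡ a) (remaining c A) → Any (λ f → Incident v f × c f ≡ a) (remaining c (e ∷ A))
    keep a seen with find seen
    ... | g , g∈ , inc , eq with g ≟ᴱ e
    ...   | yes refl = lose (remaining-∷ {A} f∈ (e≢f ∘ sym)) (vf , trans (sym ceq) eq)
    ...   | no ne    = lose (remaining-∷ {A} g∈ ne) (inc , eq)

  -- The potential of the greedy choice. Truncated subtraction keeps a surplus at one vertex from
  -- hiding a shortage at another.
  deficiency : ℕ → List (Edge n) → ℕ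
  deficiency t A = ∑ (fins n) (λ v → t ∸ supply A v)

  record Choice (A : List (Edge n)) : Set where
    field
      unique : Unique A
      full   : Full c A

  open Choice public

  choice-∷ : ∀ {A} → Choice A → ∀ {e f} → e ∈ remaining c A → f ∈ remaining c A → e ≢ f → c e ≡ c f → Choice (e ∷ A)
  choice-∷ {A} ch {e} e∈ f∈ e≢f ceq = record
    { unique = All.tabulate (λ g∈ → λ { refl → remaining⁻ {A} e∈ g∈ }) ∷ unique ch
    ; full   = full-∷ {A} (full ch) f∈ e≢f ceq }

  -- A vertex short of t has degree n - 1 ≥ t, above its supply, so two of its remaining edges share
  -- a colour, and taking one lowers the deficiency. With no such vertex, any repeated colour will
  -- do; `room` provides one.
  extend : ∀ {t r A} → t < n → k + (length A + suc r) ≤ tri n → Choice A → deficiency t A ≤ suc r →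
    Σ[ e ∈ Edge n ] (Choice (e ∷ A) × deficiency t (e ∷ A) ≤ r)
  extend {t} {r} {A} t<n room ch def with deficiency t A in eq
  ... | zero = let e , f , e∈ , f∈ , e≢f , ceq , _ = repeated (λ _ → yes tt) A enough in
      e , choice-∷ ch e∈ f∈ e≢f ceq , ≤-trans (∑-mono (fins n) (λ v → ∸-monoʳ-≤ t (supply-mono A e v))) (≤-trans (≤-reflexive eq) z≤n)
    where
    enough : palette c (λ _ → yes tt) A + ∑ A (λ _ → 1) < ∑ (edges n) (λ _ → 1)
    enough = begin-strict
      palette c (λ _ → yes tt) A + ∑ A (λ _ → 1)   ≤⟨ +-mono-≤ (≤-trans (∑-mono (fins k) (λ a → ι≤1 (seen? c (λ _ → yes tt) A a))) (≤-reflexive (trans (∑-one (fins k)) (length-fins k)))) (≤-reflexive (∑-one A)) ⟩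
      k + length A                                 <⟨ +-monoʳ-< k (m<m+n (length A) (s≤s z≤n)) ⟩
      k + (length A + suc r)                       ≤⟨ room ⟩
      tri n                                        ≡⟨ length-edges n ⟨
      length (edges n)                             ≡⟨ ∑-one (edges n) ⟨
      ∑ (edges n) (λ _ → 1)                        ∎
      where open ≤-Reasoning
  ... | suc d with ∑-positive (fins n) (λ v → t ∸ supply A v) (≤-trans (s≤s z≤n) (≤-reflexive (sym eq)))
  ...   | v , _ , pos = let e , f , e∈ , f∈ , e≢f , ceq , ve , vf = repeated (incident? v) A enough in
      e , choice-∷ ch e∈ f∈ e≢f ceq ,
      ≤-pred (≤-trans (∑-strict (fins n) (λ w → ∸-monoʳ-≤ t (supply-mono A e w)) (∈fins v) (lower e f f∈ e≢f ceq ve vf))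
                      (≤-trans (≤-reflexive eq) def))
    where
    short : supply A v < t
    short = ≰⇒> (λ le → <-irrefl (sym (m≤n⇒m∸n≡0 le)) pos)
    enough : supply A v < ∑ (edges n) (ι ∘ incident? v)
    enough = ≤-trans short (≤-pred (≤-trans t<n (degree-complete v)))
    lower : ∀ e f → f ∈ remaining c A → e ≢ f → c e ≡ c f → Incident v e → Incident v f →
            suc (t ∸ supply (e ∷ A) v) ≤ t ∸ supply A v
    lower e f f∈ e≢f ceq ve vf = ≤-trans (s≤s (∸-monoʳ-≤ t (supply-strict A v f∈ e≢f ceq ve vf))) (∸-monoʳ-< (n<1+n _) short)

  choose : ∀ {t} r A → t < n → k + (length A + r) ≤ tri n → Choice A → deficiency t A ≤ r →
    Σ[ A′ ∈ List (Edge n) ] (length A′ ≡ length A + r × Choice A′ × deficiency t A′ ≤ 0)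
  choose zero    A t<n room ch def = A , sym (+-identityʳ _) , ch , def
  choose (suc r) A t<n room ch def with extend t<n room ch def
  ... | e , ch′ , def′ with choose r (e ∷ A) t<n (≤-trans (≤-reflexive (cong (k +_) (sym (+-suc (length A) r)))) room) ch′ def′
  ...   | A′ , eq , rest = A′ , trans eq (sym (+-suc (length A) r)) , rest

-- The deficiency before any edge is chosen

ι-pos : (d : Dec P) → 1 ≤ ι d → P
ι-pos (yes p) _ = p

module Initial {n k : ℕ} (c : Coloring n k) (full₀ : Full c []) where

  open Greedy c

  mem? : (v : Fin n) (W : List (Fin n)) → Dec (v ∈ W)
  mem? v W = Any.any? (v ≟_) W

  -- A colour is seen at a vertex of `W` or occurs on an edge between the remaining vertices.
  colours-bound : ∀ {W : List (Fin n)} → Unique W → k ≤ ∑ W (supply []) + tri (n ∸ length W)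
  colours-bound {W} W-unique = begin
    k                                                               ≡⟨ trans (∑-one (fins k)) (length-fins k) ⟨
    ∑ (fins k) (λ _ → 1)                                            ≤⟨ ∑-mono (fins k) pointwise ⟩
    ∑ (fins k) (λ a → ∑ W (λ v → ι (seen? c (incident? v) [] a)) + ι (seen? c avoid? [] a))
                                                                    ≡⟨ ∑-+ (fins k) _ _ ⟩
    ∑ (fins k) (λ a → ∑ W (λ v → ι (seen? c (incident? v) [] a))) + palette c avoid? []
                                                                    ≤⟨ +-mono-≤ (≤-reflexive (∑-swap (fins k) W _)) avoiding ⟩
    ∑ W (λ v → palette c (incident? v) []) + tri (n ∸ length W)     ≤⟨ +-monoˡ-≤ _ (∑-mono W (λ v → m≤m+n _ _)) ⟩
    ∑ W (supply []) + tri (n ∸ length W)                            ∎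
    where
    open ≤-Reasoning
    out? : ∀ v → Dec (¬ (v ∈ W))
    out? v = ¬? (mem? v W)
    avoid? : (e : Edge n) → Dec (¬ (lo e ∈ W) × ¬ (hi e ∈ W))
    avoid? e = out? (lo e) ×-dec out? (hi e)
    at-vertex : ∀ a {e v} → e ∈ remaining c [] → c e ≡ a → v ∈ W → Incident v e → 1 ≤ ∑ W (λ v → ι (seen? c (incident? v) [] a))
    at-vertex a {e} {v} e∈ eq v∈ inc = ≤-trans (≤-reflexive (sym (ι-yes (seen? c (incident? v) [] a) (lose e∈ (inc , eq)))))
      (∈⇒≤∑ (λ v → ι (seen? c (incident? v) [] a)) v∈)
    pointwise : ∀ a → 1 ≤ ∑ W (λ v → ι (seen? c (incident? v) [] a)) + ι (seen? c avoid? [] a)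
    pointwise a with full₀ a
    ... | e , e∈ , eq with mem? (lo e) W | mem? (hi e) W
    ...   | yes p | _     = ≤-trans (at-vertex a e∈ eq p (inj₁ refl)) (m≤m+n _ _)
    ...   | no _  | yes p = ≤-trans (at-vertex a e∈ eq p (inj₂ refl)) (m≤m+n _ _)
    ...   | no p  | no q  = ≤-trans (≤-reflexive (sym (ι-yes (seen? c avoid? [] a) (lose e∈ ((p , q) , eq))))) (m≤n+m _ _)
    W≤ : length W ≤ ∑ (fins n) (λ v → ι (mem? v W))
    W≤ = ≤-trans (≤-reflexive (sym (∑-one W))) (∑-injection {A = λ _ → 𝟙} (λ _ → yes tt) (λ v → mem? v W) (λ w v → (mem? v W) ×-dec (w ≟ v)) W-unique (fins n)
      (λ {w} w∈ _ → w , ∈fins w , w∈ , refl) (λ _ → proj₁) (λ (_ , p) (_ , q) → trans p (sym q)))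
    outside : ∑ (fins n) (ι ∘ out?) ≤ n ∸ length W
    outside = ≤-trans (≤-reflexive (sym (trans (cong (_∸ ∑ (fins n) (λ v → ι (mem? v W))) (sym (count-complement (λ v → mem? v W)))) (m+n∸m≡n (∑ (fins n) (λ v → ι (mem? v W))) _))))
      (∸-monoʳ-≤ n W≤)
    avoiding : palette c avoid? [] ≤ tri (n ∸ length W)
    avoiding = ≤-trans (∑-injection (seen? c avoid? []) avoid? (λ a e → avoid? e ×-dec (c e ≟ a)) (fins-unique k) (edges n)
        (λ _ seen → let e , _ , p , eq = find seen in e , ∈edges e , p , eq) (λ _ → proj₁) (λ (_ , p) (_ , q) → trans (sym p) q))
      (≤-trans (≤-reflexive (edges-inside out?)) (tri-mono outside))

  1≤supply : 2 ≤ n → ∀ v → 1 ≤ supply [] v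
  1≤supply 2≤n v with ∑-positive (edges n) (ι ∘ incident? v) (≤-pred (≤-trans 2≤n (degree-complete v)))
  ... | e , _ , pos = ≤-trans (≤-trans (≤-reflexive (sym (ι-yes (seen? c (incident? v) [] (c e)) (lose (remaining⁺ {[]} {e} λ ()) (ι-pos (incident? v e) pos , refl)))))
      (∈⇒≤∑ (λ a → ι (seen? c (incident? v) [] a)) (∈fins (c e)))) (m≤m+n _ _)

  -- At most two vertices see fewer than t colours.
  initial-deficiency : ∀ s → 2 * suc s ≤ n → (3 ≤ n → suc (suc s + tri (n ∸ 2)) ≤ k) → deficiency (suc s) [] ≤ s
  initial-deficiency s 2t≤n many = ≤-trans (≤-reflexive (∑-filter short? (fins n) (λ v → t ∸ supply [] v) (λ v ¬lt → m≤n⇒m∸n≡0 (≮⇒≥ ¬lt))))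
      (cases (filter short? (fins n)) (Unique.filter⁺ short? (fins-unique n)) (λ v∈ → proj₂ (∈-filter⁻ short? {xs = fins n} v∈)))
    where
    t = suc s
    short? : ∀ v → Dec (supply [] v < t)
    short? v = supply [] v <? t
    2≤n : 2 ≤ n
    2≤n = ≤-trans (s≤s (≤-trans (s≤s z≤n) (m≤n+m _ s))) 2t≤n
    pos : ∀ v → 1 ≤ supply [] v
    pos = 1≤supply 2≤n
    4≤n : ∀ {v} → supply [] v < t → 4 ≤ n
    4≤n {v} lt = ≤-trans (*-monoʳ-≤ 2 (≤-trans (s≤s (pos v)) lt)) 2t≤n
    ∸+ : ∀ {v} → supply [] v < t → (t ∸ supply [] v) + supply [] v ≡ t
    ∸+ lt = m∸n+n≡m (<⇒≤ lt)
    cases : ∀ W → Unique W → (∀ {v} → v ∈ W → supply [] v < t) → ∑ W (λ v → t ∸ supply [] v) ≤ s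
    cases [] _ _ = z≤n
    cases (v ∷ []) _ lt = ≤-trans (≤-reflexive (+-identityʳ _)) (∸-monoʳ-≤ t (pos v))
    -- Here `colours-bound` and `many` force the two supplies to sum to at least t + 1, leaving a
    -- shortage of at most 2t - (t + 1) = s.
    cases (u ∷ v ∷ []) W! lt = linear 0 (+-mono-≤ (many (≤-trans (n≤1+n 3) (4≤n (lt (here refl))))) (+-mono-≤ (colours-bound W!)
        (+-mono-≤ (≤-reflexive (∸+ (lt (here refl)))) (≤-reflexive (∸+ (lt (there (here refl))))))))
        (shuffle s (t ∸ supply [] u) (t ∸ supply [] v) (supply [] u) (supply [] v) k (tri (n ∸ 2)))
      where
      shuffle : ∀ s a b u v k x → a + (b + 0) + (k + (u + (v + 0) + x + (suc s + suc s))) + 0 ≡ s + (suc (suc s + x) + (k + (a + u + (b + v))))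
      shuffle = solve-∀
    -- Three supplies of at most t - 1 would give k ≤ 3(t - 1) + C(n - 3, 2), and with `many` n ≤ 2t
    -- - 1.
    cases (u ∷ v ∷ w ∷ W) W! lt with m≤n⇒∃[o]m+o≡n (≤-trans (n≤1+n 3) (4≤n (lt (here refl))))
    ... | m , refl = ⊥-elim (<-irrefl refl (linear {L = 1} {R = 0} 0 (+-mono-≤ (many (s≤s (s≤s (s≤s z≤n)))) (+-mono-≤ (colours-bound three)
        (+-mono-≤ (lt (here refl)) (+-mono-≤ (lt (there (here refl))) (+-mono-≤ (lt (there (there (here refl)))) 2t≤n)))))
        (shuffle s (supply [] u) (supply [] v) (supply [] w) k m (tri m))))
      where
      three : Unique (u ∷ v ∷ w ∷ [])
      three = Unique.take⁺ 3 W!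
      shuffle : ∀ s u v w k m x → 1 + (k + (u + (v + (w + 0)) + x + (suc s + (suc s + (suc s + (3 + m)))))) + 0
        ≡ 0 + (suc (suc s + (m + x)) + (k + (suc u + (suc v + (suc w + 2 * suc s)))))
      shuffle = solve-∀

-- Assembling the upper bound

-- All colours from `r` on become one. Merging only creates coincidences, so a tree that is rainbow
-- for `c′` is rainbow for `c`.
reduce-colours : ∀ {n k r} → r < k → (c : Coloring n k) → Surjective c →
  Σ[ c′ ∈ Coloring n (suc r) ] (Surjective c′ × (∀ {e f} → c e ≡ c f → c′ e ≡ c′ f))
reduce-colours {n} {k} {r} r<k c surj = cap ∘ c , onto , cong cap
  where
  cap : Fin k → Fin (suc r)
  cap j = fromℕ< (s≤s (m⊓n≤n (toℕ j) r))
  onto : Surjective (cap ∘ c)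
  onto a with surj (fromℕ< (≤-trans (toℕ<n a) r<k))
  ... | e , eq = e , toℕ-injective (trans (toℕ-fromℕ< _) (trans (cong (λ j → toℕ j ⊓ r) eq)
      (trans (cong (_⊓ r) (toℕ-fromℕ< _)) (m≤n⇒m⊓n≡m (≤-pred (toℕ<n a))))))

tri-double : ∀ m → 2 * tri (suc m) ≡ suc m * m
tri-double zero    = refl
tri-double (suc m) = trans (*-distribˡ-+ 2 (suc m) (tri (suc m))) (trans (cong (2 * suc m +_) (tri-double m)) (shuffle m))
  where
  shuffle : ∀ m → 2 * suc m + suc m * m ≡ suc (suc m) * suc m
  shuffle = solve-∀

-- Convexity: the bound is largest at an end of the range of m.
partition-bound : ∀ t r q m → t + tri (q + suc m) ≤ r → t * suc (q + m) ≤ r → t * suc q + tri (suc m) ≤ r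
-- A clique on at most 2t vertices has at most t edges per vertex beyond the first, so breaking it
-- up does not lower the bound; a larger one gains at least t edges for each vertex it absorbs.
partition-bound t r q m h₁ h₂ with ≤-total (suc m) (2 * t)
... | inj₁ le = ≤-trans (≤-trans (+-monoʳ-≤ (t * suc q) tri≤) (≤-reflexive (shuffle t q m))) h₂
  where
  shuffle : ∀ t q m → t * suc q + t * m ≡ t * suc (q + m)
  shuffle = solve-∀
  tri≤ : tri (suc m) ≤ t * m
  tri≤ = *-cancelˡ-≤ 2 (≤-trans (≤-reflexive (tri-double m)) (≤-trans (*-monoˡ-≤ m le) (≤-reflexive (*-assoc 2 t m))))
... | inj₂ ge = ≤-trans (linear (tri q) (+-mono-≤ (≤-reflexive (sym (tri-+ q (suc m)))) (*-monoʳ-≤ q (≤-trans (m≤m+n t _) ge)))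
    (shuffle t q (tri (suc m)) (tri q) (tri (q + suc m)) (q * suc m))) h₁
  where
  shuffle : ∀ t q x y z w → t * suc q + x + (z + w) + y ≡ t + z + (y + x + w + q * t)
  shuffle = solve-∀

trees-from-choice : ∀ {n k} (c : Coloring (suc n) k) {t} A → suc (length A) ≡ t → Greedy.Choice c A → Greedy.deficiency c t A ≤ 0 →
  (∀ q m → suc q + suc m ≡ n → t * suc q + tri (suc m) < k) → HasRainbowTrees t c
trees-from-choice {n} c A refl choice deficient many = Extension.rainbow-trees c A (unique choice) (full choice) star many
  where
  open Greedy c
  star : ∀ v → suc (length A) ≤ supply A v
  star v = m∸n≡0⇒m≤n (n≤0⇒n≡0 (≤-trans (∈⇒≤∑ (λ v → suc (length A) ∸ supply A v) (∈fins v)) deficient))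

-- The two bounds on `r` are the ends of `many`: three components, and single vertices only. The
-- last hypothesis makes room for s prescribed edges beside `suc r` colours.
upper-bound : ∀ s {n r} → 2 * suc s ≤ n → (3 ≤ n → suc s + tri (n ∸ 2) ≤ r) → suc s * (n ∸ 2) ≤ r → suc r + s ≤ tri n →
  ∀ k → r < k → (c : Coloring n k) → Surjective c → HasRainbowTrees (suc s) c
upper-bound s {suc n} {r} 2t≤n h₁ h₂ room k r<k c surj =
  let c′ , surj′ , factor = reduce-colours r<k c surj
      full₀ : Full c′ []
      full₀ a = let e , eq = surj′ a in e , Greedy.remaining⁺ c′ {[]} (λ ()) , eq
      A , length-A , choice , deficient = Greedy.choose c′ {suc s} s [] t<n room
        (record { unique = [] ; full = full₀ }) (Initial.initial-deficiency c′ full₀ s 2t≤n (λ 3≤n → s≤s (h₁ 3≤n)))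
      Ts , spanning , rainbow , disjoint = trees-from-choice c′ A (cong suc length-A) choice deficient many
  in Ts , spanning , (λ i e f p q eq → rainbow i e f p q (factor eq)) , disjoint
  where
  t<n : suc s < suc n
  t<n = ≤-trans (s≤s (≤-trans (≤-reflexive (+-comm 1 s)) (+-monoʳ-≤ s (s≤s z≤n)))) 2t≤n
  many : ∀ q m → suc q + suc m ≡ n → suc s * suc q + tri (suc m) < suc r
  many q m refl = s≤s (partition-bound (suc s) r q m (h₁ (s≤s (s≤s (≤-trans (s≤s z≤n) (m≤n+m (suc m) q)))))
    (≤-trans (≤-reflexive (cong (suc s *_) (sym (+-suc q m)))) h₂))

-- Colourings without t edge-disjoint rainbow spanning trees

unique-++⁻ : ∀ (xs : List X) {ys} → Unique (xs ++ ys) → Unique xs × Unique ys × (∀ {x} → x ∈ xs → ¬ (x ∈ ys))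
unique-++⁻ []       u = [] , u , λ ()
unique-++⁻ (x ∷ xs) (x≢ ∷ u) with unique-++⁻ xs u
... | u₁ , u₂ , dis = All.tabulate (λ y∈ → All.lookup x≢ (∈-++⁺ˡ y∈)) ∷ u₁ , u₂ ,
  λ { (here refl) y∈ → All.lookup x≢ (∈-++⁺ʳ xs y∈) refl ; (there x∈) → dis x∈ }

module _ (U : List (Edge n)) where

  one-colour-outside : Coloring n (suc (length U))
  one-colour-outside e with e ∈? U
  ... | yes p = suc (index p)
  ... | no _  = zero

  outside-colour : ∀ {e} → ¬ (e ∈ U) → one-colour-outside e ≡ zero
  outside-colour {e} e∉ with e ∈? U
  ... | yes p = ⊥-elim (e∉ p)
  ... | no _  = refl

  one-colour-outside-surjective : Unique U → ∀ {e} → ¬ (e ∈ U) → Surjective one-colour-outside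
  one-colour-outside-surjective u {e} e∉ zero    = e , outside-colour e∉
  one-colour-outside-surjective u {e} e∉ (suc j) = lookup U j , at-lookup
    where
    at-lookup : one-colour-outside (lookup U j) ≡ suc j
    at-lookup with lookup U j ∈? U
    ... | yes p = cong suc (lookup-injective u (sym (lookup-index p)))
    ... | no p  = ⊥-elim (p (∈-lookup {xs = U} j))

-- A spanning tree joins the components of `N`, so it has at least `suc q` edges outside `N`. At
-- most one of them carries the common colour, so at least `q` lie in `D`, and disjointness gives t
-- * q ≤ |D|. The edge `s` ensures that the common colour occurs.
lower-bound : ∀ {n t q} (N D S : List (Edge (suc n))) s → Unique (N ++ D ++ s ∷ S) → (∀ e → e ∈ N ++ D ++ s ∷ S) →
  2 + q ≤ components N → length D < t * q → Bad (suc n) t (suc (length (N ++ D)))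
lower-bound {n} {t} {q} N D S s u complete comps small = colour , one-colour-outside-surjective U U-unique s∉ , impossible
  where
  U = N ++ D
  Z = s ∷ S
  colour = one-colour-outside U
  u′ = unique-++⁻ U (subst Unique (sym (++-assoc N D Z)) u)
  U-unique = proj₁ u′
  Z-unique : Unique Z
  Z-unique = proj₁ (proj₂ u′)
  Z∉U : ∀ {e} → e ∈ Z → ¬ (e ∈ U)
  Z∉U e∈Z e∈U = proj₂ (proj₂ u′) e∈U e∈Z
  s∉ : ¬ (s ∈ U)
  s∉ = Z∉U (here refl)
  impossible : ¬ HasRainbowTrees t colour
  impossible (Ts , spanning , rainbow , disjoint) = <-irrefl refl (begin-strict
      t * q                                                     ≡⟨ cong (_* q) (length-fins t) ⟨
      length (fins t) * q                                       ≡⟨ ∑-const (fins t) q ⟨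
      ∑ (fins t) (λ _ → q)                                      ≤⟨ ∑-mono (fins t) needed ⟩
      ∑ (fins t) (λ i → ∑ D (λ e → ι (e ∈? T i)))               ≡⟨ ∑-swap (fins t) D _ ⟩
      ∑ D (λ e → ∑ (fins t) (λ i → ι (e ∈? T i)))               ≤⟨ ∑-mono D once ⟩
      ∑ D (λ _ → 1)                                             ≡⟨ ∑-one D ⟩
      length D                                                  <⟨ small ⟩
      t * q                                                     ∎)
    where
    open ≤-Reasoning
    T : Fin t → List (Edge (suc n))
    T i = proj₁ (connected⇒list {T = Ts i} (proj₁ (spanning i)))
    T⊆ : ∀ i {e} → e ∈ T i → Ts i e
    T⊆ i = proj₁ (proj₂ (connected⇒list {T = Ts i} (proj₁ (spanning i))))
    T-connected : ∀ i → components (T i) ≤ 1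
    T-connected i = proj₂ (proj₂ (connected⇒list {T = Ts i} (proj₁ (spanning i))))
    once : ∀ e → ∑ (fins t) (λ i → ι (e ∈? T i)) ≤ 1
    once e = ∑-atMostOne (λ i → e ∈? T i) (yes tt) (fins-unique t) _ same
      where
      same : ∀ {i j} → i ∈ fins t → j ∈ fins t → e ∈ T i → e ∈ T j → i ≡ j
      same {i} {j} _ _ p r with i ≟ j
      ... | yes eq = eq
      ... | no ne  = ⊥-elim (disjoint i j ne e (T⊆ i p) (T⊆ j r))
    needed : ∀ i → q ≤ ∑ D (λ e → ι (e ∈? T i))
    needed i = linear 0 (+-mono-≤ comps (+-mono-≤ (components-++-≤ M N) (+-mono-≤ (components-anti {l = T i} {M ++ N} (⊆⇒⊑ cover))
        (+-mono-≤ (T-connected i) (+-mono-≤ (≤-reflexive M-size) common)))))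
        (shuffle q (components N) (length M) (components (M ++ N)) (components (T i)) (∑ D (λ e → ι (e ∈? T i))) (∑ Z (λ e → ι (e ∈? T i))))
      where
      M = filter (_∈? T i) (D ++ Z)
      M-size : length M ≡ ∑ D (λ e → ι (e ∈? T i)) + ∑ Z (λ e → ι (e ∈? T i))
      M-size = trans (length-filter-∑ (_∈? T i) (D ++ Z)) (∑-++ D Z _)
      cover : T i ⊆ M ++ N
      cover {e} e∈ with ∈-++⁻ N (complete e)
      ... | inj₁ p = ∈-++⁺ʳ M p
      ... | inj₂ p = ∈-++⁺ˡ (∈-filter⁺ (_∈? T i) p e∈)
      common : ∑ Z (λ e → ι (e ∈? T i)) ≤ 1
      common = ∑-atMostOne (_∈? T i) (yes tt) Z-unique _ (λ {e} {f} e∈ f∈ p r →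
        let lo≡ , hi≡ = rainbow i e f (T⊆ i p) (T⊆ i r) (trans (outside-colour U (Z∉U e∈)) (sym (outside-colour U (Z∉U f∈)))) in edge-≡ lo≡ hi≡)
      shuffle : ∀ q a m b c x y → q + (a + (m + b + (c + (1 + (x + y + 1))))) + 0 ≡ x + (2 + q + (a + (b + (c + (m + y)))))
      shuffle = solve-∀

unique-++-swap : ∀ (xs : List X) {ys} → Unique (xs ++ ys) → Unique (ys ++ xs)
unique-++-swap xs u = let u₁ , u₂ , dis = unique-++⁻ xs u in Unique.++⁺ u₂ u₁ (λ (p , q) → dis q p)

lower-bound-split : ∀ {n t q d} (R N : List (Edge (suc n))) → Unique (R ++ N) → (∀ e → e ∈ R ++ N) →
  2 + q ≤ components N → suc d ≡ t * q → suc d ≤ length R → Bad (suc n) t (length N + suc d)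
lower-bound-split {n} {t} {q} {d} R N u complete comps eq d<R = split (drop d R) refl
  where
  D = take d R
  len : length D ≡ d
  len = trans (length-take d R) (m≤n⇒m⊓n≡m (<⇒≤ d<R))
  split : ∀ Z → drop d R ≡ Z → Bad (suc n) t (length N + suc d)
  split [] none = ⊥-elim (<-irrefl (trans (sym len) (cong length (trans (sym (++-identityʳ D)) (trans (cong (D ++_) (sym none)) (take++drop≡id d R))))) d<R)
  split (s ∷ S) some = subst (Bad (suc n) t) count (lower-bound {q = q} N D S s
      (subst (λ R → Unique (N ++ R)) (sym R≡) (unique-++-swap R u)) complete′ comps (≤-reflexive (trans (cong suc len) eq)))
    where
    R≡ : D ++ s ∷ S ≡ R
    R≡ = trans (cong (D ++_) (sym some)) (take++drop≡id d R)
    complete′ : ∀ e → e ∈ N ++ D ++ s ∷ S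
    complete′ e with ∈-++⁻ R (complete e)
    ... | inj₁ p = ∈-++⁺ʳ N (subst (e ∈_) (sym R≡) p)
    ... | inj₂ p = ∈-++⁺ˡ p
    count : suc (length (N ++ D)) ≡ length N + suc d
    count = trans (cong suc (trans (length-++ N) (cong (length N +_) len))) (sym (+-suc (length N) d))

-- With `N` empty the 2 + n vertices are the components, so q = n.
lower-bound-small : ∀ {n t r} → suc r ≡ t * n → suc r ≤ tri (2 + n) → Bad (2 + n) t (suc r)
lower-bound-small {n} eq le = lower-bound-split {q = n} (edges (2 + n)) []
  (subst Unique (sym (++-identityʳ (edges (2 + n)))) (edges-unique (2 + n))) (λ e → ∈-++⁺ˡ (∈edges e))
  (≤-reflexive (sym (components-[] (2 + n)))) eq (≤-trans le (≤-reflexive (sym (length-edges (2 + n)))))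

lower-bound-large : ∀ n s → s ≤ n → Bad (3 + n) (suc s) (tri (suc n) + suc s)
lower-bound-large n s s≤n = subst (λ x → Bad (3 + n) (suc s) (x + suc s))
    (trans (length-map shift (map shift (edges (suc n)))) (trans (length-map shift (edges (suc n))) (length-edges (suc n))))
    (lower-bound-split {q = 1} R clique (subst Unique E≡ (edges-unique (3 + n))) (λ e → subst (e ∈_) E≡ (∈edges e))
      three (sym (*-identityʳ (suc s))) enough)
  where
  clique = map shift (map shift (edges (suc n)))
  R = map spoke (fins (2 + n)) ++ map shift (map spoke (fins (suc n)))
  E≡ : edges (3 + n) ≡ R ++ clique
  E≡ = trans (cong (map spoke (fins (2 + n)) ++_) (map-++ shift (map spoke (fins (suc n))) (map shift (edges (suc n)))))
             (sym (++-assoc (map spoke (fins (2 + n))) (map shift (map spoke (fins (suc n)))) clique))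
  enough : suc s ≤ length R
  enough = ≤-trans (≤-trans (s≤s (≤-trans s≤n (n≤1+n n))) (≤-reflexive (sym (trans (length-map spoke (fins (2 + n))) (length-fins (2 + n))))))
                   (≤-trans (m≤m+n _ _) (≤-reflexive (sym (length-++ (map spoke (fins (2 + n)))))))
  -- Constant along the clique's edges, so its three values witness three components, and q = 1.
  class : Fin (3 + n) → Fin 3
  class zero          = zero
  class (suc zero)    = suc zero
  class (suc (suc _)) = suc (suc zero)
  constant : ∀ {e} → e ∈ clique → class (lo e) ≡ class (hi e)
  constant e∈ with ∈-map⁻ shift e∈
  ... | _ , f∈ , refl with ∈-map⁻ shift f∈
  ...   | _ , _ , refl = refl
  classes : 3 ≤ distinct class
  classes = +-mono-≤ (≤-reflexive (sym (ι-yes (¬? (hits? (λ v → class (suc v)) zero)) λ { (zero , ()) ; (suc _ , ()) })))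
            (+-mono-≤ (≤-reflexive (sym (ι-yes (¬? (hits? (λ v → class (suc (suc v))) (suc zero))) λ { (_ , ()) })))
                      (1≤distinct (λ v → class (suc (suc v)))))
  three : 3 ≤ components clique
  three = ≤-trans (≤-trans classes (distinct-anti (label-minimal (λ u v → class u ≡ class v) refl sym trans clique constant)))
                  (≤-reflexive (sym (components≡distinct clique)))

-- The three ranges of n

tri-even : ∀ s → tri (2 + 2 * s) ≡ suc s * suc (2 * s)
tri-even s = *-cancelˡ-≡ _ _ 2 (trans (tri-double (suc (2 * s))) (shuffle s))
  where
  shuffle : ∀ s → suc (suc (2 * s)) * suc (2 * s) ≡ 2 * (suc s * suc (2 * s))
  shuffle = solve-∀

large : ∀ s n → 2 * suc s + 2 ≤ n → IsR n (suc s) ((n ∸ 2) C 2 + suc s)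
large s n le with m≤n⇒∃[o]m+o≡n (≤-trans (≤-reflexive (shuffle s)) le)
  where
  shuffle : ∀ s → 4 + 2 * s ≡ 2 * suc s + 2
  shuffle = solve-∀
... | m , refl = subst (λ x → IsR (3 + N) (suc s) (x + suc s)) (sym (C2≡tri (suc N)))
    (inj₂ (lower-bound-large N s s≤N) ,
     upper-bound s 2t≤n (λ _ → ≤-reflexive (+-comm (suc s) (tri (suc N)))) discrete room)
  where
  N = suc (2 * s + m)
  2s≤N : 2 * suc s ≤ suc N
  2s≤N = ≤-trans (≤-reflexive (*-suc 2 s)) (s≤s (s≤s (m≤m+n (2 * s) m)))
  s≤N : s ≤ N
  s≤N = ≤-trans (m≤m+n s _) (≤-trans (m≤m+n (2 * s) m) (n≤1+n _))
  2t≤n : 2 * suc s ≤ 3 + N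
  2t≤n = ≤-trans 2s≤N (≤-trans (n≤1+n _) (n≤1+n _))
  -- This is t(n - 3) ≤ C(n - 2, 2), from 2t ≤ n - 2: the clique end of the range dominates.
  tri≥ : suc s * N ≤ tri (suc N)
  tri≥ = *-cancelˡ-≤ 2 (≤-trans (≤-reflexive (sym (*-assoc 2 (suc s) N))) (≤-trans (*-monoˡ-≤ N 2s≤N) (≤-reflexive (sym (tri-double N)))))
  discrete : suc s * suc N ≤ tri (suc N) + suc s
  discrete = ≤-trans (≤-reflexive (*-suc (suc s) N)) (≤-trans (≤-reflexive (+-comm (suc s) _)) (+-monoˡ-≤ (suc s) tri≥))
  room : suc (tri (suc N) + suc s) + s ≤ tri (3 + N)
  room = linear (2 + N) 2s≤N (shuffle s N (tri (suc N)))
    where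
    shuffle : ∀ s N x → suc (x + suc s) + s + suc N + (2 + N) ≡ suc (suc N) + (suc N + x) + 2 * suc s
    shuffle = solve-∀

odd : ∀ s n → n ≡ 2 * suc s + 1 → IsR n (suc s) ((n ∸ 1) C 2)
odd s n eq with trans eq (shuffle s)
  where
  shuffle : ∀ s → 2 * suc s + 1 ≡ 3 + 2 * s
  shuffle = solve-∀
... | refl = subst (IsR (3 + 2 * s) (suc s)) (sym (C2≡tri (2 + 2 * s)))
    (inj₂ (lower-bound-small (tri-even s) (tri-mono (n≤1+n (2 + 2 * s)))) ,
     upper-bound s (≤-trans (≤-reflexive (*-suc 2 s)) (n≤1+n _)) (λ _ → +-monoˡ-≤ _ (s≤s (m≤m+n s _)))
       (≤-reflexive (sym (tri-even s))) room)
  where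
  room : suc (tri (2 + 2 * s)) + s ≤ tri (3 + 2 * s)
  room = ≤-trans (≤-reflexive (trans (cong suc (+-comm _ s)) refl)) (+-monoˡ-≤ (tri (2 + 2 * s)) (s≤s (≤-trans (m≤m+n s _) (n≤1+n _))))

even : ∀ s n → n ≡ 2 * suc s → IsR n (suc s) (n C 2 ∸ suc s)
even s n eq with trans eq (*-suc 2 s)
... | refl = subst (IsR (2 + 2 * s) (suc s)) (sym r≡)
    (lower s , upper-bound s (≤-reflexive (*-suc 2 s)) (clique s) ≤-refl (≤-reflexive (trans (shuffle s) (sym (tri-even s)))))
  where
  r≡ : (2 + 2 * s) C 2 ∸ suc s ≡ suc s * (2 * s)
  r≡ = trans (cong (_∸ suc s) (trans (C2≡tri (2 + 2 * s)) (trans (tri-even s) (*-suc (suc s) (2 * s))))) (m+n∸m≡n (suc s) _)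
  shuffle : ∀ s → suc (suc s * (2 * s)) + s ≡ suc s * suc (2 * s)
  shuffle = solve-∀
  lower : ∀ s → (suc s * (2 * s) ≡ 0) ⊎ Bad (2 + 2 * s) (suc s) (suc s * (2 * s))
  -- For t = 1 and n = 2 the value is 0, the convention for an empty maximum.
  lower zero     = inj₁ refl
  lower (suc s′) = inj₂ (lower-bound-small {t = 2 + s′} refl
    (≤-trans (*-monoʳ-≤ (2 + s′) (n≤1+n (2 * suc s′))) (≤-reflexive (sym (tri-even (suc s′))))))
  clique : ∀ s → 3 ≤ 2 + 2 * s → suc s + tri (2 * s) ≤ suc s * (2 * s)
  -- At n = 2 the clique bound would read 1 ≤ 0; this is why `upper-bound` guards it by `3 ≤ n`.
  clique zero     3≤ = ⊥-elim (<-irrefl refl 3≤)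
  clique (suc s′) _  = linear (suc (2 * s′)) (≤-reflexive (tri-even (suc s′))) (shuffle′ s′ (tri (2 * suc s′)))
    where
    shuffle′ : ∀ s x → 2 + s + x + (2 + s) * suc (2 * suc s) + suc (2 * s) ≡ (2 + s) * (2 * suc s) + (suc (2 * suc s) + (2 * suc s + x))
    shuffle′ = solve-∀

theorem4 : (t n : ℕ) → 1 ≤ t →
    ((2 * t + 2 ≤ n → IsR n t ((n ∸ 2) C 2 + t))
    × (n ≡ 2 * t + 1 → IsR n t ((n ∸ 1) C 2))
    × (n ≡ 2 * t → IsR n t (n C 2 ∸ t)))
theorem4 (suc s) n (s≤s z≤n) = large s n , odd s n , even s n
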